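{- For every $\varepsilon>0$ there exists a simple $2$-connected planar cubic graph $G$ such that every traveling salesman tour of $G$ has length at least $(1.25-\varepsilon)\,|V(G)|$.
   Context: A traveling salesman tour (TSP tour) of a connected graph $G$ is a closed walk in $G$ that visits every vertex of $G$; its length is the number of edges of the walk counted with multiplicity. -}

module Defs where

open import Data.Nat using (ℕ; _≥_)
open import Data.Bool using (Bool; true; false)
open import Data.Fin using (Fin)
open import Data.Fin.Subset using (∣_∣)
open import Data.Vec using (tabulate)
open import Data.List using (List; []; _∷_; last; length)
open import Data.List.Relation.Unary.All using (All)
open import Data.List.Relation.Unary.Linked using (Linked)
open import Data.List.Membership.Propositional using (_∈_)
open import Data.Maybe using (just)
open import Data.Product using (Σ; ∃; _×_; _,_; proj₁; proj₂)
open import Data.Sum using (_⊎_)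
open import Data.Integer using (+_)
open import Data.Rational using (ℚ; 0ℚ; 1ℚ; _+_; _-_; _*_; _≤_; _/_)
open import Relation.Binary.PropositionalEquality using (_≡_; _≢_)

Adjacency : ℕ → Set
Adjacency n = Fin n → Fin n → Bool

module _ {n : ℕ} (adj : Adjacency n) where

  Adj : Fin n → Fin n → Set
  Adj i j = adj i j ≡ true

  -- simple (undirected, loopless; no multi-edges by construction)
  IsSimple : Set
  IsSimple = (∀ i j → adj i j ≡ adj j i) × (∀ i → adj i i ≡ false)

  degree : Fin n → ℕ
  degree i = ∣ tabulate (adj i) ∣

  Cubic : Set
  Cubic = ∀ i → degree i ≡ 3

  WalkWithin : (Fin n → Set) → Fin n → Fin n → Set
  WalkWithin P u v = Σ (List (Fin n)) λ ws →
    Linked Adj (u ∷ ws) × last (u ∷ ws) ≡ just v × All P (u ∷ ws)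

  Everything : Fin n → Set
  Everything _ = Fin n

  Connected : Set
  Connected = ∀ u v → WalkWithin Everything u v

  ConnectedWithout : Fin n → Set
  ConnectedWithout x = ∀ u v → u ≢ x → v ≢ x → WalkWithin (λ w → w ≢ x) u v

  TwoConnected : Set
  TwoConnected = n ≥ 3 × Connected × (∀ x → ConnectedWithout x)

  record TSPTour : Set where
    field
      start : Fin n
      rest  : List (Fin n)
      walk  : Linked Adj (start ∷ rest)
      closed : last (start ∷ rest) ≡ just start
      visitsAll : ∀ v → v ∈ (start ∷ rest)

  tourLength : TSPTour → ℕ
  tourLength t = length (TSPTour.rest t)

-- Planarity: a straight-line crossing-free drawing with rational coordinates.
Point : Set
Point = ℚ × ℚ

OnSegment : Point → Point → Point → Set
OnSegment p q z = Σ ℚ λ t → 0ℚ ≤ t × t ≤ 1ℚ ×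
  proj₁ z ≡ proj₁ p + t * (proj₁ q - proj₁ p) ×
  proj₂ z ≡ proj₂ p + t * (proj₂ q - proj₂ p)

module _ {n : ℕ} (adj : Adjacency n) where

  IsPlanarEmbedding : (Fin n → Point) → Set
  IsPlanarEmbedding pos =
    (∀ i j → pos i ≡ pos j → i ≡ j) ×
    (∀ w a b → Adj adj a b → OnSegment (pos a) (pos b) (pos w) → w ≡ a ⊎ w ≡ b) ×
    (∀ a b c d → Adj adj a b → Adj adj c d → ∀ z →
       OnSegment (pos a) (pos b) z → OnSegment (pos c) (pos d) z →
       ((a ≡ c × b ≡ d) ⊎ (a ≡ d × b ≡ c)) ⊎ (∃ λ w → z ≡ pos w))

  Planar : Set
  Planar = ∃ λ pos → IsPlanarEmbedding pos

{-# OPTIONS --safe #-}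
module Submission where

-- The graph is a ladder whose rungs are alternately single edges and diamonds
-- (K₄ minus an edge), 8 vertices per period, closed off at both ends.  A tour
-- crosses every edge cut an even, positive number of times.  In particular the
-- two rails of the ladder are used with equal parity everywhere, and parity
-- propagates along the ladder: at each rung it flips exactly if the rung is used
-- an odd number of times.  A diamond costs 5 edges when used oddly and 6 otherwise;
-- going through the cases, a period together with the rails into it costs at least
-- 10 + [incoming rails even] − [outgoing rails even].  The parity terms telescope,
-- so a tour needs 10 edges per 8 vertices up to an additive constant.

-- A bound of 10 per period is false: with odd incoming rails, a tour that sends odd flow through
-- the diamond spends 4 + 5 = 9 edges. It then leaves with even rails, and these make the next
-- period dearer. The parity of the rails is thus a potential, and the inequality has to carry it.
-- Three unbounded quantities stand between the case analysis and a finite check. Multiplicities are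
-- unbounded, but evenness and positivity of cuts survive removing parallel pairs, so 0, 1 and 2
-- suffice. The ladder is unbounded, but for one period everything before it and everything after it
-- can each be contracted to a point. In the drawing there are unboundedly many pairs of blocks, but
-- all blocks are translates of one picture, and a separating linear functional with a suitable sign
-- keeps separating when one side is shifted further away. Each time a decision procedure does what
-- remains.

open import Defs

-- The ladder graph: simplicity and 3-regularity.

module Ladder where

  open import Data.Bool using (Bool; true; false; _∧_; _∨_; if_then_else_)
  open import Data.Bool.ListAction using (any)
  open import Data.Bool.Properties as Bool using (⇔→≡; ∨-identityʳ; ∨-zeroʳ)
  open import Data.Fin using (Fin; zero; suc; toℕ; combine; quotient; remainder; _↑ˡ_; _↑ʳ_)
  open import Data.Fin.Patterns
  open import Data.Fin.Properties as Fin using (remQuot-combine; combine-remQuot)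
  open import Data.Fin.Subset using (∣_∣)
  open import Data.List using (List; []; _∷_; _++_)
  open import Data.Nat
  open import Data.Nat.Properties
  open import Algebra.Properties.CommutativeMonoid.Sum +-0-commutativeMonoid using (sum; sum-cong-≗; ∑-distrib-+)
  open import Data.Product using (_×_; _,_; proj₁; proj₂)
  open import Data.Vec using (tabulate)
  open import Function using (_∘_; mk⇔)
  open import Relation.Binary.PropositionalEquality
  open import Relation.Nullary using (Dec; does; contradiction)
  open import Relation.Nullary.Decidable using (from-yes; map′; _→-dec_; _×-dec_)
  open import Relation.Unary using (Decidable)

  Site : Set
  Site = Fin 8

  -- u₀u₁ and v₀v₁ are the rails inside a block, u₀v₀ is one rung and the diamond
  -- d₁d₂d₃d₄ (without the edge d₁d₄) the other.
  pattern u₀ = 0F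
  pattern u₁ = 1F
  pattern v₀ = 2F
  pattern v₁ = 3F
  pattern d₁ = 4F
  pattern d₂ = 5F
  pattern d₃ = 6F
  pattern d₄ = 7F

  -- The end blocks repair the degrees without parallel edges. The first block has no incoming
  -- rails, so its diamond hangs on `u₀` and `v₀` and the rung `u₁v₁` fills the remaining degree;
  -- the last block has no outgoing rails, and `u₁v₁` replaces them.
  data Kind : Set where
    first middle final : Kind

  blockEdges : Kind → List (Site × Site)
  blockEdges k = kindEdges k ++
    (u₀ , u₁) ∷ (v₀ , v₁) ∷ (u₀ , v₀) ∷
    (d₁ , d₂) ∷ (d₁ , d₃) ∷ (d₂ , d₃) ∷ (d₂ , d₄) ∷ (d₃ , d₄) ∷ []
    where
    kindEdges : Kind → List (Site × Site)
    kindEdges first  = (u₀ , d₁) ∷ (v₀ , d₄) ∷ (u₁ , v₁) ∷ []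
    kindEdges middle = (u₁ , d₁) ∷ (v₁ , d₄) ∷ []
    kindEdges final  = (u₁ , d₁) ∷ (v₁ , d₄) ∷ (u₁ , v₁) ∷ []

  railEdges : List (Site × Site)
  railEdges = (u₁ , u₀) ∷ (v₁ , v₀) ∷ []

  listed : List (Site × Site) → Site → Site → Bool
  listed es r s = any (λ (p , q) → does (p Fin.≟ r) ∧ does (q Fin.≟ s)) es

  inner : Kind → Site → Site → Bool
  inner k r s = listed (blockEdges k) r s ∨ listed (blockEdges k) s r

  rail : Site → Site → Bool
  rail = listed railEdges

  allKinds? : {P : Kind → Set} → Decidable P → Dec (∀ k → P k)
  allKinds? P? = map′ (λ { (x , y , z) → λ { first → x ; middle → y ; final → z } })
    (λ h → h first , h middle , h final) (P? first ×-dec P? middle ×-dec P? final)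

  inner-sym : ∀ k r s → inner k r s ≡ true → inner k s r ≡ true
  inner-sym = from-yes (allKinds? λ k → Fin.all? λ r → Fin.all? λ s →
    (inner k r s Bool.≟ true) →-dec (inner k s r Bool.≟ true))

  inner-irrefl : ∀ k r → inner k r r ≡ false
  inner-irrefl = from-yes (allKinds? λ k → Fin.all? λ r → inner k r r Bool.≟ false)

  bit : Bool → ℕ
  bit true  = 1
  bit false = 0

  n≡ᵇn : ∀ n → (n ≡ᵇ n) ≡ true
  n≡ᵇn zero    = refl
  n≡ᵇn (suc n) = n≡ᵇn n

  sn≢ᵇn : ∀ n → (suc n ≡ᵇ n) ≡ false
  sn≢ᵇn zero    = refl
  sn≢ᵇn (suc n) = sn≢ᵇn n

  n≢ᵇsn : ∀ n → (n ≡ᵇ suc n) ≡ false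
  n≢ᵇsn zero    = refl
  n≢ᵇsn (suc n) = n≢ᵇsn n

  n≢ᵇssn : ∀ n → (n ≡ᵇ suc (suc n)) ≡ false
  n≢ᵇssn zero    = refl
  n≢ᵇssn (suc n) = n≢ᵇssn n

  ≡ᵇ-sound : ∀ m n → (m ≡ᵇ n) ≡ true → m ≡ n
  ≡ᵇ-sound zero    zero    _ = refl
  ≡ᵇ-sound (suc m) (suc n) e = cong suc (≡ᵇ-sound m n e)

  ∣tabulate∣ : ∀ {n} (f : Fin n → Bool) → ∣ tabulate f ∣ ≡ sum (bit ∘ f)
  ∣tabulate∣ {zero}  f = refl
  ∣tabulate∣ {suc n} f with f zero
  ... | true  = cong suc (∣tabulate∣ (f ∘ suc))
  ... | false = ∣tabulate∣ (f ∘ suc)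

  sum-split : ∀ m n (f : Fin (m + n) → ℕ) → sum f ≡ sum (f ∘ (_↑ˡ n)) + sum (f ∘ (m ↑ʳ_))
  sum-split zero    n f = refl
  sum-split (suc m) n f = trans (cong (f zero +_) (sum-split m n (f ∘ suc))) (sym (+-assoc (f zero) _ _))

  sum-combine : ∀ m n (f : Fin (m * n) → ℕ) → sum f ≡ sum (λ j → sum (λ r → f (combine {m} {n} j r)))
  sum-combine zero    n f = refl
  sum-combine (suc m) n f = trans (sum-split n (m * n) f)
    (cong (sum (f ∘ (_↑ˡ (m * n))) +_) (sum-combine m n (f ∘ (n ↑ʳ_))))

  sum-zero : ∀ m (f : Fin m → ℕ) → (∀ j → f j ≡ 0) → sum f ≡ 0
  sum-zero zero    f z = refl
  sum-zero (suc m) f z = cong₂ _+_ (z zero) (sum-zero m (f ∘ suc) (z ∘ suc))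

  sum-indicator : ∀ m t x → sum (λ (j : Fin m) → bit (t ≡ᵇ toℕ j) * x) ≡ bit (t <ᵇ m) * x
  sum-indicator zero    t       x = refl
  sum-indicator (suc m) zero    x = trans (cong (1 * x +_) (sum-zero m _ λ _ → refl)) (+-identityʳ _)
  sum-indicator (suc m) (suc t) x = sum-indicator m t x

  -- Blocks are numbered from 0 to suc N.
  module _ (N : ℕ) where

    blocks : ℕ
    blocks = 2 + N

    kind : ℕ → Kind
    kind zero    = first
    kind (suc j) = if j ≡ᵇ N then final else middle

    link : ℕ → Site → ℕ → Site → Bool
    link j r k s = (j ≡ᵇ k) ∧ inner (kind j) r s ∨ ((suc j ≡ᵇ k) ∧ rail r s ∨ (j ≡ᵇ suc k) ∧ rail s r)

    data Link : ℕ → Site → ℕ → Site → Set where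
      within : ∀ {j r s} → inner (kind j) r s ≡ true → Link j r j s
      up     : ∀ {j r s} → rail r s ≡ true → Link j r (suc j) s
      down   : ∀ {j r s} → rail s r ≡ true → Link (suc j) r j s

    link⇒Link : ∀ j r k s → link j r k s ≡ true → Link j r k s
    link⇒Link j r k s e with j ≡ᵇ k in jk | inner (kind j) r s in i
    link⇒Link j r k s e | true  | true with refl ← ≡ᵇ-sound j k jk = within i
    link⇒Link j r k s e | true  | false with refl ← ≡ᵇ-sound j k jk
      rewrite sn≢ᵇn j | n≢ᵇsn j = contradiction e λ ()
    link⇒Link j r k s e | false | _ with suc j ≡ᵇ k in sjk | rail r s in p | j ≡ᵇ suc k in jsk | rail s r in q
    ... | true  | true  | _ | _ with refl ← ≡ᵇ-sound (suc j) k sjk = up p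
    ... | true  | false | true | true with refl ← ≡ᵇ-sound j (suc k) jsk = down q
    ... | false | _     | true | true with refl ← ≡ᵇ-sound j (suc k) jsk = down q

    Link⇒link : ∀ {j r k s} → Link j r k s → link j r k s ≡ true
    Link⇒link (within {j} i) rewrite n≡ᵇn j | i = refl
    Link⇒link (up {j} p) rewrite n≢ᵇsn j | n≡ᵇn j | p = refl
    Link⇒link (down {j} p) rewrite sn≢ᵇn (suc j) | n≡ᵇn j | p with suc (suc j) ≡ᵇ j
    ... | true  = ∨-zeroʳ _
    ... | false = refl

    Link-sym : ∀ {j r k s} → Link j r k s → Link k s j r
    Link-sym (within {j} {r} {s} i) = within (inner-sym (kind j) r s i)
    Link-sym (up p)   = down p
    Link-sym (down p) = up p

    Vertex : Set
    Vertex = Fin (blocks * 8)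

    block : Vertex → ℕ
    block v = toℕ (quotient {blocks} 8 v)

    site : Vertex → Site
    site = remainder {blocks} 8

    at : Fin blocks → Site → Vertex
    at = combine

    block-at : ∀ j r → block (at j r) ≡ toℕ j
    block-at j r = cong (toℕ ∘ proj₁) (remQuot-combine {blocks} j r)

    site-at : ∀ j r → site (at j r) ≡ r
    site-at j r = cong proj₂ (remQuot-combine {blocks} j r)

    at-quotient-site : ∀ v → at (quotient {blocks} 8 v) (site v) ≡ v
    at-quotient-site = combine-remQuot {blocks} 8

    vertex-ext : ∀ {v w} → block v ≡ block w → site v ≡ site w → v ≡ w
    vertex-ext {v} {w} b s = trans (sym (at-quotient-site v)) (trans
      (cong₂ at (Fin.toℕ-injective b) s) (at-quotient-site w))

    ladder : Adjacency (blocks * 8)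
    ladder v w = link (block v) (site v) (block w) (site w)

    adj⇒Link : ∀ {v w} → Adj ladder v w → Link (block v) (site v) (block w) (site w)
    adj⇒Link = link⇒Link _ _ _ _

    ladder-simple : IsSimple ladder
    ladder-simple = (λ v w → ⇔→≡ (mk⇔ (flip {v} {w}) (flip {w} {v}))) , irrefl
      where
      flip : ∀ {v w} → Adj ladder v w → Adj ladder w v
      flip {v} {w} = Link⇒link ∘ Link-sym ∘ adj⇒Link {v} {w}
      irrefl : ∀ v → ladder v v ≡ false
      irrefl v rewrite inner-irrefl (kind (block v)) (site v) | n≡ᵇn (block v) | sn≢ᵇn (block v) | n≢ᵇsn (block v) = refl

    innerDegree : Kind → Site → ℕ
    innerDegree k r = sum (λ s → bit (inner k r s))

    upDegree downDegree : Site → ℕ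
    upDegree r = sum (λ s → bit (rail r s))
    downDegree r = sum (λ s → bit (rail s r))

    -- The conditions `k = j`, `k = j + 1` and `j = k + 1` exclude one another, so the disjunction
    -- in `link` counts as a sum.
    rowDegree : ∀ j r k → sum (λ s → bit (link j r k s)) ≡
      bit (j ≡ᵇ k) * innerDegree (kind j) r + (bit (suc j ≡ᵇ k) * upDegree r + bit (j ≡ᵇ suc k) * downDegree r)
    rowDegree j r k with j ≡ᵇ k in jk
    ... | true with refl ← ≡ᵇ-sound j k jk rewrite sn≢ᵇn j | n≢ᵇsn j =
      trans (sum-cong-≗ {8} λ s → cong bit (∨-identityʳ (inner (kind j) r s))) (sym (trans (+-identityʳ _) (+-identityʳ _)))
    ... | false with suc j ≡ᵇ k in sjk
    ...   | true with refl ← ≡ᵇ-sound (suc j) k sjk rewrite n≢ᵇssn j =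
      trans (sum-cong-≗ {8} λ s → cong bit (∨-identityʳ (rail r s))) (sym (trans (+-identityʳ _) (+-identityʳ _)))
    ...   | false with j ≡ᵇ suc k
    ...     | true  = sym (+-identityʳ _)
    ...     | false = refl

    degreeFormula : ∀ v → degree ladder v ≡
      sum (λ (k : Fin blocks) → bit (block v ≡ᵇ toℕ k) * innerDegree (kind (block v)) (site v) +
        (bit (suc (block v) ≡ᵇ toℕ k) * upDegree (site v) + bit (block v ≡ᵇ suc (toℕ k)) * downDegree (site v)))
    degreeFormula v = trans (∣tabulate∣ (ladder v)) (trans (sum-combine blocks 8 (bit ∘ ladder v))
      (sum-cong-≗ {blocks} λ k → trans
        (sum-cong-≗ {8} λ s → cong bit (cong₂ (link (block v) (site v)) (block-at k s) (site-at k s)))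
        (rowDegree (block v) (site v) (toℕ k))))

    ladder-cubic : Cubic ladder
    ladder-cubic v = begin
      degree ladder v                       ≡⟨ degreeFormula v ⟩
      sum (λ k → f k + (g k + h k))         ≡⟨ ∑-distrib-+ f (λ k → g k + h k) ⟩
      sum f + sum (λ k → g k + h k)         ≡⟨ cong (sum f +_) (∑-distrib-+ g h) ⟩
      sum f + (sum g + sum h)
        ≡⟨ cong₂ (λ x y → x + (y + sum h)) (sum-indicator blocks j _) (sum-indicator blocks (suc j) _) ⟩
      deg₃ j r                              ≡⟨ total j r (Fin.toℕ<n (quotient {blocks} 8 v)) ⟩
      3                                     ∎
      where
      open ≡-Reasoning
      j = block v
      r = site v
      f g h : Fin blocks → ℕ
      f k = bit (j ≡ᵇ toℕ k) * innerDegree (kind j) r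
      g k = bit (suc j ≡ᵇ toℕ k) * upDegree r
      h k = bit (j ≡ᵇ suc (toℕ k)) * downDegree r
      -- The downward sum stays unevaluated because its index is shifted: it vanishes for block 0,
      -- and for a block `suc j` it selects block `j`. The factor `suc j <ᵇ blocks` removes the
      -- upward rails of the last block.
      deg₃ : ∀ j r → ℕ
      deg₃ j r = bit (j <ᵇ blocks) * innerDegree (kind j) r + (bit (suc j <ᵇ blocks) * upDegree r +
        sum (λ (k : Fin blocks) → bit (j ≡ᵇ suc (toℕ k)) * downDegree r))
      <ᵇ-true : ∀ {m n} → m < n → (m <ᵇ n) ≡ true
      <ᵇ-true (s≤s {n = n} z≤n) = refl
      <ᵇ-true (s≤s (s≤s p)) = <ᵇ-true (s≤s p)
      n≮ᵇn : ∀ n → (n <ᵇ n) ≡ false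
      n≮ᵇn zero = refl
      n≮ᵇn (suc n) = n≮ᵇn n
      ≢⇒< : ∀ m n → m < suc n → (m ≡ᵇ n) ≡ false → m < n
      ≢⇒< m n m<sn e = ≤∧≢⇒< (≤-pred m<sn) λ { refl → contradiction (trans (sym (n≡ᵇn m)) e) λ () }
      total : ∀ j r → j < blocks → deg₃ j r ≡ 3
      total zero r _ rewrite sum-zero blocks (λ k → 0 * downDegree r) (λ _ → refl) =
        from-yes (Fin.all? λ r → (1 * innerDegree first r + (1 * upDegree r + 0)) ≟ 3) r
      total (suc j) r (s≤s j<)
        rewrite <ᵇ-true j< | sum-indicator blocks j (downDegree r) | <ᵇ-true (m≤n⇒m≤1+n j<)
        with j ≡ᵇ N in e
      ... | true with refl ← ≡ᵇ-sound j N e rewrite n≮ᵇn j =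
        from-yes (Fin.all? λ r → (1 * innerDegree final r + (0 + 1 * downDegree r)) ≟ 3) r
      ... | false rewrite <ᵇ-true (≢⇒< j N j< e) =
        from-yes (Fin.all? λ r → (1 * innerDegree middle r + (1 * upDegree r + 1 * downDegree r)) ≟ 3) r

-- Connectedness, also after removal of one vertex.

module Connectivity where

  open Ladder
  open import Data.Bool using (true)
  open import Data.Bool.Properties as Bool using ()
  open import Data.Fin using (Fin; zero; toℕ; fromℕ<; quotient)
  open import Data.Fin.Properties as Fin using (toℕ-fromℕ<; fromℕ<-toℕ; toℕ<n)
  open import Data.List using (List; []; _∷_; _++_)
  open import Data.List.Membership.Propositional using (_∈_)
  open import Data.List.Membership.DecPropositional (Fin._≟_ {8}) using (_∈?_)
  open import Data.List.Relation.Unary.All using ([]; _∷_)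
  open import Data.List.Relation.Unary.Any using (here; there)
  open import Data.List.Relation.Unary.Linked as Linked using (Linked; []; [-]; _∷_)
  open import Data.Maybe using (Maybe; just; nothing)
  open import Data.Maybe.Properties using (just-injective; ≡-dec)
  open import Data.Nat using (ℕ; zero; suc; _<_; z≤n; s≤s; _≟_)
  open import Data.Nat.Properties using (<-trans; n<1+n)
  open import Data.Product using (Σ; _×_; _,_; proj₁)
  open import Function using (_∘_)
  open import Level using (0ℓ)
  open import Relation.Binary using (Rel)
  open import Relation.Binary.Construct.Closure.ReflexiveTransitive using (Star; ε; _◅_; _◅◅_; reverse)
  open import Relation.Binary.PropositionalEquality
  open import Relation.Nullary using (Dec; yes; no; contradiction; ¬?)
  open import Relation.Nullary.Decidable using (from-yes; _→-dec_; _×-dec_)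

  module _ {A : Set} {R : Rel A 0ℓ} where

    linked⇒Star : ∀ {x xs y} → Linked R (x ∷ xs) → y ∈ x ∷ xs → Star R x y
    linked⇒Star _        (here refl) = ε
    linked⇒Star (r ∷ rs) (there y∈)  = r ◅ linked⇒Star rs y∈

    linked-joins : ∀ {xs y z} → (∀ {v w} → R v w → R w v) → Linked R xs → y ∈ xs → z ∈ xs → Star R y z
    linked-joins {_ ∷ _} R-sym rs y∈ z∈ = reverse R-sym (linked⇒Star rs y∈) ◅◅ linked⇒Star rs z∈

  module _ {n} (adj : Adjacency n) (P : Fin n → Set) where

    Within : Rel (Fin n) 0ℓ
    Within v w = P v × P w × Adj adj v w

    Star⇒WalkWithin : ∀ {v w} → P v → Star Within v w → WalkWithin adj P v w
    Star⇒WalkWithin Pv ε = [] , [-] , refl , Pv ∷ []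
    Star⇒WalkWithin Pv ((_ , Px , vx) ◅ xs) with Star⇒WalkWithin Px xs
    ... | ws , l , e , Pws = _ ∷ ws , vx ∷ l , e , Pv ∷ Pws

  hamiltonianCycle : Kind → List Site
  hamiltonianCycle first = u₀ ∷ u₁ ∷ v₁ ∷ v₀ ∷ d₄ ∷ d₃ ∷ d₂ ∷ d₁ ∷ []
  hamiltonianCycle _     = u₀ ∷ u₁ ∷ d₁ ∷ d₂ ∷ d₃ ∷ d₄ ∷ v₁ ∷ v₀ ∷ []

  -- Deleting a site from a Hamiltonian cycle of a block leaves a Hamiltonian path.
  splitAround : Maybe Site → List Site → List Site
  splitAround nothing  rs = rs
  splitAround (just q) rs = go [] rs
    where
    go : List Site → List Site → List Site
    go before [] = before
    go before (r ∷ rs) with q Fin.≟ r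
    ... | yes _ = rs ++ before
    ... | no  _ = go (before ++ r ∷ []) rs

  blockPath : Kind → Maybe Site → List Site
  blockPath k f = splitAround f (hamiltonianCycle k)

  IsBlockPath : Kind → Maybe Site → Set
  IsBlockPath k f = Linked (λ r s → inner k r s ≡ true) (blockPath k f) ×
    (∀ r → f ≢ just r → r ∈ blockPath k f) × (∀ r → r ∈ blockPath k f → f ≢ just r)

  isBlockPath? : ∀ k f → Dec (IsBlockPath k f)
  isBlockPath? k f = Linked.linked? (λ r s → inner k r s Bool.≟ true) (blockPath k f)
    ×-dec Fin.all? (λ r → ¬? (≡-dec Fin._≟_ f (just r)) →-dec (r ∈? blockPath k f))
    ×-dec Fin.all? (λ r → (r ∈? blockPath k f) →-dec ¬? (≡-dec Fin._≟_ f (just r)))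

  isBlockPath : ∀ k f → IsBlockPath k f
  isBlockPath k nothing  = from-yes (allKinds? λ k → isBlockPath? k nothing) k
  isBlockPath k (just q) = from-yes (allKinds? λ k → Fin.all? λ q → isBlockPath? k (just q)) k q

  -- forbidden j is the removed site of block j; the rail from site r to site s
  -- of the next block survives everywhere.
  module Survivors (N : ℕ) (forbidden : ℕ → Maybe Site)
    (r s : Site) (r-s : rail r s ≡ true)
    (r-ok : ∀ j → forbidden j ≢ just r) (s-ok : ∀ j → forbidden j ≢ just s) where

    private
      G = ladder N

    Allowed : Vertex N → Set
    Allowed v = forbidden (block N v) ≢ just (site N v)

    _⟿_ : Rel (Vertex N) 0ℓ
    _⟿_ = Star (Within G Allowed)

    Within-sym : ∀ {v w} → Within G Allowed v w → Within G Allowed w v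
    Within-sym {v} {w} (Pv , Pw , vw) = Pw , Pv , trans (sym (proj₁ (ladder-simple N) v w)) vw

    allowed-at : ∀ j t → forbidden (toℕ j) ≢ just t → Allowed (at N j t)
    allowed-at j t ok rewrite block-at N j t | site-at N j t = ok

    adj-at : ∀ j t k t′ → Link N (toℕ j) t (toℕ k) t′ → Adj G (at N j t) (at N k t′)
    adj-at j t k t′ l rewrite block-at N j t | site-at N j t | block-at N k t′ | site-at N k t′ = Link⇒link N l

    withinBlock : ∀ j t t′ → forbidden (toℕ j) ≢ just t → forbidden (toℕ j) ≢ just t′ → at N j t ⟿ at N j t′
    withinBlock j t t′ t-ok t′-ok with isBlockPath (kind N (toℕ j)) (forbidden (toℕ j))
    ... | path , covers , avoids = lift (linked-joins step-sym (annotate path avoids) (covers t t-ok) (covers t′ t′-ok))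
      where
      Step : Rel Site 0ℓ
      Step p q = forbidden (toℕ j) ≢ just p × forbidden (toℕ j) ≢ just q × inner (kind N (toℕ j)) p q ≡ true
      step-sym : ∀ {p q} → Step p q → Step q p
      step-sym {p} {q} (Pp , Pq , pq) = Pq , Pp , inner-sym (kind N (toℕ j)) p q pq
      annotate : ∀ {ps} → Linked (λ p q → inner (kind N (toℕ j)) p q ≡ true) ps →
        (∀ p → p ∈ ps → forbidden (toℕ j) ≢ just p) → Linked Step ps
      annotate []       ok = []
      annotate [-]      ok = [-]
      annotate (l ∷ ls) ok = (ok _ (here refl) , ok _ (there (here refl)) , l) ∷ annotate ls (λ p → ok p ∘ there)
      lift : ∀ {p q} → Star Step p q → at N j p ⟿ at N j q
      lift ε = ε
      lift ((Pp , Pq , pq) ◅ rest) =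
        (allowed-at j _ Pp , allowed-at j _ Pq , adj-at j _ j _ (within pq)) ◅ lift rest

    -- The copies of `s` serve as hubs of the blocks: inside a block the surviving path leads from
    -- `s` to `r`, and the rail leads on to the next `s`.
    alongRail : ∀ j (j< : j < blocks N) → at N zero s ⟿ at N (fromℕ< j<) s
    alongRail zero    (s≤s z≤n) = ε
    alongRail (suc j) j+1< = alongRail j j< ◅◅ withinBlock j₀ s r (s-ok _) (r-ok _) ◅◅
        ((allowed-at j₀ r (r-ok _) , allowed-at j₁ s (s-ok _) , adj-at j₀ r j₁ s rung) ◅ ε)
      where
      j< = <-trans (n<1+n j) j+1<
      j₀ = fromℕ< j<
      j₁ = fromℕ< j+1<
      rung : Link N (toℕ j₀) r (toℕ j₁) s
      rung rewrite toℕ-fromℕ< j< | toℕ-fromℕ< j+1< = up r-s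

    fromStart : ∀ v → Allowed v → at N zero s ⟿ v
    fromStart v ok = subst (at N zero s ⟿_) (at-quotient-site N v)
      (subst (λ k → at N zero s ⟿ at N k s) (fromℕ<-toℕ j (toℕ<n j)) (alongRail (toℕ j) (toℕ<n j))
        ◅◅ withinBlock j s (site N v) (s-ok _) ok)
      where j = quotient {blocks N} 8 v

    joined : ∀ v w → Allowed v → Allowed w → v ⟿ w
    joined v w v-ok w-ok = reverse (λ {y} {z} → Within-sym {y} {z}) (fromStart v v-ok) ◅◅ fromStart w w-ok

  module _ (N : ℕ) where

    ladder-connected : Connected (ladder N)
    -- `Everything` is the vertex type at each vertex, so any vertex serves as its proof.
    ladder-connected v w = Star⇒WalkWithin (ladder N) _ v
        (weaken (joined v w (λ ()) (λ ())))
      where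
      open Survivors N (λ _ → nothing) u₁ u₀ refl (λ _ ()) (λ _ ())
      weaken : ∀ {v w} → v ⟿ w → Star (Within (ladder N) (λ _ → Vertex N)) v w
      weaken ε = ε
      weaken {v} ((_ , _ , vx) ◅ rest) = (v , v , vx) ◅ weaken rest

    -- A vertex lies on the u-rails or on the v-rails or on neither, so one of the two families
    -- joins all blocks after its removal; the block that lost it is still spanned by a path.
    ladder-connectedWithout : ∀ x → ConnectedWithout (ladder N) x
    ladder-connectedWithout x v w v≢x w≢x = Star⇒WalkWithin (ladder N) _ v≢x
        (choose (survivingRail (site N x)))
      where
      forbidden : ℕ → Maybe Site
      forbidden j with block N x ≟ j
      ... | yes _ = just (site N x)
      ... | no  _ = nothing

      forbidden≢ : ∀ {t} → site N x ≢ t → ∀ j → forbidden j ≢ just t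
      forbidden≢ ≢t j with block N x ≟ j
      ... | yes _ = ≢t ∘ just-injective
      ... | no  _ = λ ()

      forbidden-x : forbidden (block N x) ≡ just (site N x)
      forbidden-x with block N x ≟ block N x
      ... | yes _ = refl
      ... | no ≢  = contradiction refl ≢

      survivingRail : ∀ q → Σ Site λ r → Σ Site λ s → rail r s ≡ true × q ≢ r × q ≢ s
      survivingRail u₀ = v₁ , v₀ , refl , (λ ()) , λ ()
      survivingRail u₁ = v₁ , v₀ , refl , (λ ()) , λ ()
      survivingRail v₀ = u₁ , u₀ , refl , (λ ()) , λ ()
      survivingRail v₁ = u₁ , u₀ , refl , (λ ()) , λ ()
      survivingRail d₁ = u₁ , u₀ , refl , (λ ()) , λ ()
      survivingRail d₂ = u₁ , u₀ , refl , (λ ()) , λ ()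
      survivingRail d₃ = u₁ , u₀ , refl , (λ ()) , λ ()
      survivingRail d₄ = u₁ , u₀ , refl , (λ ()) , λ ()

      choose : (Σ Site λ r → Σ Site λ s → rail r s ≡ true × site N x ≢ r × site N x ≢ s) →
        Star (Within (ladder N) (_≢ x)) v w
      choose (r , s , r-s , ≢r , ≢s) = weaken (joined v w (allowed v≢x) (allowed w≢x))
        where
        open Survivors N forbidden r s r-s (forbidden≢ ≢r) (forbidden≢ ≢s)
        allowed : ∀ {y} → y ≢ x → Allowed y
        allowed {y} y≢x with block N x ≟ block N y
        ... | yes b = λ e → y≢x (sym (vertex-ext N b (just-injective e)))
        ... | no  _ = λ ()
        avoids : ∀ {y} → Allowed y → y ≢ x
        avoids ok refl = ok forbidden-x
        weaken : ∀ {y z} → y ⟿ z → Star (Within (ladder N) (_≢ x)) y z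
        weaken ε = ε
        weaken ((Py , Pz , yz) ◅ rest) = (avoids Py , avoids Pz , yz) ◅ weaken rest

    ladder-twoConnected : TwoConnected (ladder N)
    ladder-twoConnected = s≤s (s≤s (s≤s z≤n)) , ladder-connected , ladder-connectedWithout

-- Cost inequalities for edge multiplicities with even positive cuts.

module EvenCuts where

  open Ladder
  open import Data.Bool using (Bool; T; true; false; _∧_; _∨_; not; _xor_)
  open import Data.Bool.Properties using (not-involutive)
  open import Data.List using (List; []; _∷_; map)
  open import Data.Nat
  open import Data.Nat.ListAction using (sum)
  open import Data.Vec as Vec using (Vec; []; _∷_)
  open import Data.Nat.Properties
  open import Data.Product using (_×_; _,_; proj₁; proj₂)
  open import Function using (_∘_)
  open import Relation.Binary.PropositionalEquality

  even : ℕ → Bool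
  even zero    = true
  even (suc n) = not (even n)

  isZero : ℕ → Bool
  isZero zero    = true
  isZero (suc _) = false

  evenPositive : ℕ → Bool
  evenPositive n = even n ∧ not (isZero n)

  even-+ : ∀ m n → even (m + n) ≡ not (even m xor even n)
  even-+ zero    n = sym (not-involutive (even n))
  even-+ (suc m) n rewrite even-+ m n with even m
  ... | true  = not-involutive _
  ... | false = refl

  isZero-+ : ∀ m n → isZero (m + n) ≡ isZero m ∧ isZero n
  isZero-+ zero    n = refl
  isZero-+ (suc m) n = refl

  -- Deleting pairs of parallel edges from a closed walk until each edge is used
  -- at most twice keeps all its cuts even and positive.
  reduce : ℕ → ℕ
  reduce 0                   = 0
  reduce 1                   = 1
  reduce 2                   = 2
  reduce (suc (suc (suc n))) = reduce (suc n)

  reduce≤ : ∀ n → reduce n ≤ n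
  reduce≤ 0 = z≤n
  reduce≤ 1 = ≤-refl
  reduce≤ 2 = ≤-refl
  reduce≤ (suc (suc (suc n))) = ≤-trans (reduce≤ (suc n)) (s≤s (m≤n+m n 2))

  even-reduce : ∀ n → even (reduce n) ≡ even n
  even-reduce 0 = refl
  even-reduce 1 = refl
  even-reduce 2 = refl
  even-reduce (suc (suc (suc n))) = trans (even-reduce (suc n)) (sym (not-involutive _))

  isZero-reduce : ∀ n → isZero (reduce n) ≡ isZero n
  isZero-reduce 0 = refl
  isZero-reduce 1 = refl
  isZero-reduce 2 = refl
  isZero-reduce (suc (suc (suc n))) = isZero-reduce (suc n)

  -- Whether a sum is even and whether it is zero depend only on the same two facts about each
  -- summand, and `reduce` preserves both.
  evenPositive-reduce : ∀ ns → evenPositive (sum (map reduce ns)) ≡ evenPositive (sum ns)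
  evenPositive-reduce ns = cong₂ (λ x y → x ∧ not y) (evens ns) (zeros ns)
    where
    evens : ∀ ns → even (sum (map reduce ns)) ≡ even (sum ns)
    evens []       = refl
    evens (n ∷ ns) = trans (even-+ (reduce n) _) (trans
      (cong₂ (λ x y → not (x xor y)) (even-reduce n) (evens ns)) (sym (even-+ n _)))
    zeros : ∀ ns → isZero (sum (map reduce ns)) ≡ isZero (sum ns)
    zeros []       = refl
    zeros (n ∷ ns) = trans (isZero-+ (reduce n) _) (trans
      (cong₂ _∧_ (isZero-reduce n) (zeros ns)) (sym (isZero-+ n _)))

  sum-reduce≤ : ∀ ns → sum (map reduce ns) ≤ sum ns
  sum-reduce≤ []       = z≤n
  sum-reduce≤ (n ∷ ns) = +-mono-≤ (reduce≤ n) (sum-reduce≤ ns)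

  ∧-split : ∀ {x y} → x ∧ y ≡ true → x ≡ true × y ≡ true
  ∧-split {true} e = refl , e

  -- A Boolean search rather than a proof-producing one, so that `refl` settles the 3^7 cases of a
  -- claim about seven multiplicities.
  holdsUpTo2 : ∀ k → (Vec ℕ k → Bool) → Bool
  holdsUpTo2 zero    f = f []
  holdsUpTo2 (suc k) f = on 0 ∧ on 1 ∧ on 2
    where on = λ n → holdsUpTo2 k (λ ns → f (n ∷ ns))

  holdsUpTo2-reduce : ∀ k f → holdsUpTo2 k f ≡ true → ∀ ns → f (Vec.map reduce ns) ≡ true
  holdsUpTo2-reduce zero    f e []       = e
  holdsUpTo2-reduce (suc k) f e (n ∷ ns) = holdsUpTo2-reduce k (λ ms → f (reduce n ∷ ms)) (pick n) ns
    where
    on : ℕ → Bool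
    on n = holdsUpTo2 k (λ ms → f (n ∷ ms))
    pick : ∀ n → on (reduce n) ≡ true
    pick 0 = proj₁ (∧-split e)
    pick 1 = proj₁ (∧-split {on 1} (proj₂ (∧-split {on 0} e)))
    pick 2 = proj₂ (∧-split {on 1} (proj₂ (∧-split {on 0} e)))
    pick (suc (suc (suc n))) = pick (suc n)

  infixr 4 _⇒_
  _⇒_ : List ℕ → Bool → Bool
  ns ⇒ y = not (evenPositive (sum ns)) ∨ y

  ⇒-elim : ∀ ns {y} → (map reduce ns ⇒ y) ≡ true → evenPositive (sum ns) ≡ true → y ≡ true
  ⇒-elim ns e ok rewrite evenPositive-reduce ns | ok = e

  ≤ᵇ-sound : ∀ m n → (m ≤ᵇ n) ≡ true → m ≤ n
  ≤ᵇ-sound m n e = ≤ᵇ⇒≤ m n (subst T (sym e) _)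

  EvenCut : List ℕ → Set
  EvenCut ns = evenPositive (sum ns) ≡ true

  -- x and y are the links of a diamond to u₁ and v₁.
  diamond-cost : ∀ x y d₁₂ d₁₃ d₂₃ d₂₄ d₃₄ →
    EvenCut (x ∷ d₁₂ ∷ d₁₃ ∷ []) → EvenCut (d₁₂ ∷ d₂₃ ∷ d₂₄ ∷ []) →
    EvenCut (d₁₃ ∷ d₂₃ ∷ d₃₄ ∷ []) → EvenCut (y ∷ d₂₄ ∷ d₃₄ ∷ []) →
    EvenCut (y ∷ d₁₂ ∷ d₁₃ ∷ []) → EvenCut (x ∷ d₂₄ ∷ d₃₄ ∷ []) → EvenCut (x ∷ y ∷ []) →
    6 ≤ bit (not (even x)) + sum (x ∷ y ∷ d₁₂ ∷ d₁₃ ∷ d₂₃ ∷ d₂₄ ∷ d₃₄ ∷ [])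
  diamond-cost x y d₁₂ d₁₃ d₂₃ d₂₄ d₃₄ c₁ c₂ c₃ c₄ c₅ c₆ c₇ =
    -- The inequality is proved for the reduced multiplicities; passing back to the original ones
    -- fixes the parity term and can only enlarge the sum.
    ≤-trans (≤ᵇ-sound 6 _ reduced) (+-mono-≤ (≤-reflexive (cong (bit ∘ not) (even-reduce x)))
      (sum-reduce≤ (x ∷ y ∷ d₁₂ ∷ d₁₃ ∷ d₂₃ ∷ d₂₄ ∷ d₃₄ ∷ [])))
    where
    claim : Vec ℕ 7 → Bool
    claim (x ∷ y ∷ d₁₂ ∷ d₁₃ ∷ d₂₃ ∷ d₂₄ ∷ d₃₄ ∷ []) =
      x ∷ d₁₂ ∷ d₁₃ ∷ [] ⇒ d₁₂ ∷ d₂₃ ∷ d₂₄ ∷ [] ⇒ d₁₃ ∷ d₂₃ ∷ d₃₄ ∷ [] ⇒ y ∷ d₂₄ ∷ d₃₄ ∷ [] ⇒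
      -- The cuts around three diamond vertices forbid detached pieces. For instance `x = 2` with
      -- the triangle `d₂d₃d₄` and nothing else costs only 5 and passes all cuts but the one around
      -- `d₂`, `d₃`, `d₄`.
      y ∷ d₁₂ ∷ d₁₃ ∷ [] ⇒ x ∷ d₂₄ ∷ d₃₄ ∷ [] ⇒ x ∷ y ∷ [] ⇒
      (6 ≤ᵇ bit (not (even x)) + sum (x ∷ y ∷ d₁₂ ∷ d₁₃ ∷ d₂₃ ∷ d₂₄ ∷ d₃₄ ∷ []))
    checked : holdsUpTo2 7 claim ≡ true
    checked = refl
    reduced = ⇒-elim (x ∷ y ∷ []) (⇒-elim (x ∷ d₂₄ ∷ d₃₄ ∷ []) (⇒-elim (y ∷ d₁₂ ∷ d₁₃ ∷ [])
      (⇒-elim (y ∷ d₂₄ ∷ d₃₄ ∷ []) (⇒-elim (d₁₃ ∷ d₂₃ ∷ d₃₄ ∷ []) (⇒-elim (d₁₂ ∷ d₂₃ ∷ d₂₄ ∷ [])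
      (⇒-elim (x ∷ d₁₂ ∷ d₁₃ ∷ [])
        (holdsUpTo2-reduce 7 claim checked (x ∷ y ∷ d₁₂ ∷ d₁₃ ∷ d₂₃ ∷ d₂₄ ∷ d₃₄ ∷ []))
      c₁) c₂) c₃) c₄) c₅) c₆) c₇

  -- uᵢ, vᵢ are the rails into a block, uₘ, vₘ the rails inside it, e the rung u₀v₀,
  -- uₒ a rail out of the block and x the link from u₁ to the diamond.
  rungs-cost : ∀ uᵢ vᵢ uₘ vₘ e x uₒ →
    EvenCut (uᵢ ∷ vᵢ ∷ []) → EvenCut (uₘ ∷ vₘ ∷ []) →
    EvenCut (uᵢ ∷ uₘ ∷ e ∷ []) → EvenCut (vᵢ ∷ vₘ ∷ e ∷ []) →
    EvenCut (vᵢ ∷ uₘ ∷ e ∷ []) → EvenCut (uᵢ ∷ vₘ ∷ e ∷ []) → EvenCut (uₘ ∷ x ∷ uₒ ∷ []) →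
    10 + bit (even uᵢ) + bit (not (even x)) ≤ 6 + bit (even uₒ) + sum (uᵢ ∷ vᵢ ∷ uₘ ∷ vₘ ∷ e ∷ [])
  rungs-cost uᵢ vᵢ uₘ vₘ e x uₒ c₁ c₂ c₃ c₄ c₅ c₆ c₇ =
    ≤-trans (≤-reflexive (cong₂ (λ p q → 10 + bit p + bit (not q)) (sym (even-reduce uᵢ)) (sym (even-reduce x))))
      (≤-trans (≤ᵇ-sound _ _ reduced)
        (+-mono-≤ (≤-reflexive (cong (λ p → 6 + bit p) (even-reduce uₒ))) (sum-reduce≤ (uᵢ ∷ vᵢ ∷ uₘ ∷ vₘ ∷ e ∷ []))))
    where
    claim : Vec ℕ 7 → Bool
    claim (uᵢ ∷ vᵢ ∷ uₘ ∷ vₘ ∷ e ∷ x ∷ uₒ ∷ []) =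
      uᵢ ∷ vᵢ ∷ [] ⇒ uₘ ∷ vₘ ∷ [] ⇒ uᵢ ∷ uₘ ∷ e ∷ [] ⇒ vᵢ ∷ vₘ ∷ e ∷ [] ⇒
      -- The two crosswise cuts forbid a break at the rung: `uᵢ = vₘ = 2` with `vᵢ`, `uₘ`, `e` zero
      -- passes every cut at a single vertex and every cut through both rails.
      vᵢ ∷ uₘ ∷ e ∷ [] ⇒ uᵢ ∷ vₘ ∷ e ∷ [] ⇒ uₘ ∷ x ∷ uₒ ∷ [] ⇒
      -- The diamond pays 6 minus one if `x` is odd; the rails and the rung must pay the rest of 10
      -- plus the change of potential. The subtracted terms are moved across.
      (10 + bit (even uᵢ) + bit (not (even x)) ≤ᵇ 6 + bit (even uₒ) + sum (uᵢ ∷ vᵢ ∷ uₘ ∷ vₘ ∷ e ∷ []))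
    checked : holdsUpTo2 7 claim ≡ true
    checked = refl
    reduced = ⇒-elim (uₘ ∷ x ∷ uₒ ∷ []) (⇒-elim (uᵢ ∷ vₘ ∷ e ∷ []) (⇒-elim (vᵢ ∷ uₘ ∷ e ∷ [])
      (⇒-elim (vᵢ ∷ vₘ ∷ e ∷ []) (⇒-elim (uᵢ ∷ uₘ ∷ e ∷ []) (⇒-elim (uₘ ∷ vₘ ∷ [])
      (⇒-elim (uᵢ ∷ vᵢ ∷ [])
        (holdsUpTo2-reduce 7 claim checked (uᵢ ∷ vᵢ ∷ uₘ ∷ vₘ ∷ e ∷ x ∷ uₒ ∷ []))
      c₁) c₂) c₃) c₄) c₅) c₆) c₇

-- Contracting all but one block, and counting steps of a walk.

module Contraction where

  open Ladder
  open EvenCuts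
  open import Data.Bool using (Bool; true; false; _∧_; _∨_; not; _xor_)
  open import Data.Bool.Properties as Bool using (xor-same; ∨-comm)
  open import Data.Fin.Properties as Fin using ()
  open import Data.List using (List; []; _∷_; last; length; map)
  open import Data.List.Membership.Propositional using (_∈_)
  open import Data.List.Relation.Unary.Any using (here; there)
  open import Data.List.Relation.Unary.Linked using (Linked; [-]; _∷_)
  open import Data.Maybe using (just)
  open import Data.Nat
  open import Data.Nat.ListAction using (sum)
  open import Data.Nat.Properties
  open import Algebra.Properties.CommutativeSemigroup +-commutativeSemigroup using (interchange)
  open import Data.Product using (_×_; _,_)
  open import Function using (_∘_)
  open import Relation.Binary.PropositionalEquality
  open import Relation.Nullary using (Dec; does)
  open import Relation.Nullary.Decidable using (from-yes; _→-dec_; _×-dec_; map′)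
  open import Relation.Unary using (Decidable)

  -- A middle block with everything before it contracted to one spot and
  -- everything after it to another.
  data Spot : Set where
    before after : Spot
    on           : Site → Spot

  Edge : Set
  Edge = Spot × Spot

  allSpots? : ∀ {P : Spot → Set} → Decidable P → Dec (∀ p → P p)
  allSpots? P? = map′ (λ { (x , y , z) → λ { before → x ; after → y ; (on r) → z r } })
    (λ h → h before , h after , h ∘ on) (P? before ×-dec P? after ×-dec Fin.all? (P? ∘ on))

  _≟ˢ_ : Spot → Spot → Bool
  before ≟ˢ before = true
  after  ≟ˢ after  = true
  on r   ≟ˢ on s   = does (r Fin.≟ s)
  _      ≟ˢ _      = false

  -- The pairs of spots that a step of the tour can project to. A step inside a contracted part
  -- stays at its spot, hence the two reflexive cases.
  near : Spot → Spot → Bool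
  near before before = true
  near after  after  = true
  near before (on s) = rail u₁ s ∨ rail v₁ s
  near (on r) before = rail u₁ r ∨ rail v₁ r
  near (on r) after  = rail r u₀ ∨ rail r v₀
  near after  (on s) = rail s u₀ ∨ rail s v₀
  near (on r) (on s) = inner middle r s
  near before after  = false
  near after  before = false

  uses : Edge → Spot → Spot → ℕ
  uses (e , f) p q = bit ((e ≟ˢ p) ∧ (f ≟ˢ q) ∨ (e ≟ˢ q) ∧ (f ≟ˢ p))

  separates : (Spot → Bool) → Spot → Spot → ℕ
  separates S p q = bit (S p xor S q)

  -- A pointwise identity on possible steps; summed along the tour, it turns the total of `w` into a
  -- sum of edge multiplicities.
  Counts : (Spot → Spot → ℕ) → List Edge → Set
  Counts w es = ∀ p q → near p q ≡ true → w p q ≡ sum (map (λ e → uses e p q) es)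

  counts? : ∀ w es → Dec (Counts w es)
  counts? w es = allSpots? λ p → allSpots? λ q →
    (near p q Bool.≟ true) →-dec (w p q ≟ sum (map (λ e → uses e p q) es))

  isBefore isAfter : Spot → Bool
  isBefore before = true
  isBefore _      = false
  isAfter after = true
  isAfter _     = false

  module _ {A : Set} where

    weight : (A → A → ℕ) → A → List A → ℕ
    weight w x []       = 0
    weight w x (y ∷ ys) = w x y + weight w y ys

    weight-cong : ∀ {R : A → A → Set} {w w′ : A → A → ℕ} → (∀ {x y} → R x y → w x y ≡ w′ x y) →
      ∀ {x ys} → Linked R (x ∷ ys) → weight w x ys ≡ weight w′ x ys
    weight-cong w≡ [-]      = refl
    weight-cong w≡ (r ∷ rs) = cong₂ _+_ (w≡ r) (weight-cong w≡ rs)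

    weight-+ : ∀ (w w′ : A → A → ℕ) x ys → weight (λ p q → w p q + w′ p q) x ys ≡ weight w x ys + weight w′ x ys
    weight-+ w w′ x []       = refl
    weight-+ w w′ x (y ∷ ys) = trans (cong (w x y + w′ x y +_) (weight-+ w w′ y ys)) (interchange (w x y) _ _ _)

    weight-0 : ∀ x ys → weight (λ _ _ → 0) x ys ≡ 0
    weight-0 x []       = refl
    weight-0 x (y ∷ ys) = weight-0 y ys

    weight-sum : ∀ {E : Set} (w : E → A → A → ℕ) es x ys →
      weight (λ p q → sum (map (λ e → w e p q) es)) x ys ≡ sum (map (λ e → weight (w e) x ys) es)
    weight-sum w []       x ys = weight-0 x ys
    weight-sum w (e ∷ es) x ys = trans (weight-+ (w e) _ x ys) (cong (weight (w e) x ys +_) (weight-sum w es x ys))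

    weight≤length : ∀ (w : A → A → ℕ) → (∀ x y → w x y ≤ 1) → ∀ x ys → weight w x ys ≤ length ys
    weight≤length w w≤ x []       = z≤n
    weight≤length w w≤ x (y ∷ ys) = +-mono-≤ (w≤ x y) (weight≤length w w≤ y ys)

    crossings : (A → Bool) → A → List A → ℕ
    crossings S = weight (λ x y → bit (S x xor S y))

    even-bit : ∀ x → even (bit x) ≡ not x
    even-bit true  = refl
    even-bit false = refl

    -- Modulo 2 the contributions `S x xor S y` of consecutive steps telescope to the two ends of
    -- the walk.
    even-crossings : ∀ S x ys z → last (x ∷ ys) ≡ just z → even (crossings S x ys) ≡ not (S x xor S z)
    even-crossings S x []       .x refl rewrite xor-same (S x) = refl
    even-crossings S x (y ∷ ys) z  e
      rewrite even-+ (bit (S x xor S y)) (crossings S y ys) | even-bit (S x xor S y) | even-crossings S y ys z e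
      = telescope (S x) (S y) (S z)
      where
      telescope : ∀ i j k → not (not (i xor j) xor not (j xor k)) ≡ not (i xor k)
      telescope true  true  true  = refl
      telescope true  true  false = refl
      telescope true  false true  = refl
      telescope true  false false = refl
      telescope false true  true  = refl
      telescope false true  false = refl
      telescope false false true  = refl
      telescope false false false = refl

    uncrossed : ∀ S x ys → crossings S x ys ≡ 0 → ∀ {v} → v ∈ x ∷ ys → S v ≡ S x
    uncrossed S x ys       e (here refl) = refl
    uncrossed S x (y ∷ ys) e (there v∈) with S x | S y in eq
    ... | true  | true  = trans (uncrossed S y ys e v∈) eq
    ... | false | false = trans (uncrossed S y ys e v∈) eq

  data Position : Set where
    less same greater : Position

  position : ℕ → ℕ → Position
  position zero    zero    = same
  position zero    (suc i) = less
  position (suc j) zero    = greater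
  position (suc j) (suc i) = position j i

  position-refl : ∀ i → position i i ≡ same
  position-refl zero    = refl
  position-refl (suc i) = position-refl i

  position-same : ∀ j i → position j i ≡ same → j ≡ i
  position-same zero    zero    _ = refl
  position-same (suc j) (suc i) e = cong suc (position-same j i e)

  position-suc : ∀ i → position (suc i) i ≡ greater
  position-suc zero    = refl
  position-suc (suc i) = position-suc i

  position-pred : ∀ i → position i (suc i) ≡ less
  position-pred zero    = refl
  position-pred (suc i) = position-pred i

  spot : Position → Site → Spot
  spot less    r = before
  spot same    r = on r
  spot greater r = after

  -- Both sides say `j ≤ i`. Through this identity the contractions at consecutive blocks are
  -- compared, which the telescoping needs.
  isBefore-suc : ∀ j i r → isBefore (spot (position j (suc i)) r) ≡ not (isAfter (spot (position j i) r))
  isBefore-suc zero    zero    r = refl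
  isBefore-suc zero    (suc i) r = refl
  isBefore-suc (suc j) (suc i) r = isBefore-suc j i r
  isBefore-suc (suc zero)    zero r = refl
  isBefore-suc (suc (suc j)) zero r = refl

  -- Of the nine pairs of positions only four occur for neighbouring blocks; above all, no rail
  -- jumps from `less` to `greater`.
  data Successive (i : ℕ) : ℕ → Position → Position → Set where
    bothBefore : ∀ {j} → Successive i j less less
    entering   : ∀ {j} → suc j ≡ i → Successive i j less same
    leaving    : ∀ {j} → j ≡ i → Successive i j same greater
    bothAfter  : ∀ {j} → Successive i j greater greater

  successive : ∀ i j → Successive i j (position j i) (position (suc j) i)
  successive zero    zero    = leaving refl
  successive zero    (suc j) = bothAfter
  successive (suc zero)    zero = entering refl
  successive (suc (suc i)) zero = bothBefore
  successive (suc i) (suc j) with position j i | position (suc j) i | successive i j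
  ... | _ | _ | bothBefore    = bothBefore
  ... | _ | _ | entering refl = entering refl
  ... | _ | _ | leaving refl  = leaving refl
  ... | _ | _ | bothAfter     = bothAfter

  near-sym : ∀ p q → near p q ≡ true → near q p ≡ true
  near-sym = from-yes (allSpots? λ p → allSpots? λ q → (near p q Bool.≟ true) →-dec (near q p Bool.≟ true))

  rail-leaves : ∀ r s → rail r s ≡ true → near (on r) after ≡ true
  rail-leaves = from-yes (Fin.all? λ r → Fin.all? λ s →
    (rail r s Bool.≟ true) →-dec (near (on r) after Bool.≟ true))

  rail-enters : ∀ r s → rail r s ≡ true → near before (on s) ≡ true
  rail-enters = from-yes (Fin.all? λ r → Fin.all? λ s →
    (rail r s Bool.≟ true) →-dec (near before (on s) Bool.≟ true))

  contract : ℕ → ℕ → Site → Spot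
  contract i j r = spot (position j i) r

  Link⇒near : ∀ N i → kind N i ≡ middle → ∀ {j r k s} → Link N j r k s →
    near (contract i j r) (contract i k s) ≡ true
  Link⇒near N i i-mid = go
    where
    upward : ∀ j r s → rail r s ≡ true → near (contract i j r) (contract i (suc j) s) ≡ true
    upward j r s p with position j i | position (suc j) i | successive i j
    ... | _ | _ | bothBefore    = refl
    ... | _ | _ | bothAfter     = refl
    ... | _ | _ | entering refl = rail-enters r s p
    ... | _ | _ | leaving refl  = rail-leaves r s p
    go : ∀ {j r k s} → Link N j r k s → near (contract i j r) (contract i k s) ≡ true
    go (within {j} {r} {s} e) with position j i in eq
    ... | less    = refl
    ... | greater = refl
    ... | same rewrite position-same j i eq | i-mid = e
    go (up {j} {r} {s} p)     = upward j r s p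
    go (down {j} {r} {s} p)   = near-sym (contract i j s) (contract i (suc j) r) (upward j s r p)

  -- Both indicators vanish on a step that does not pass between blocks `i` and `i + 1`, and on a
  -- step that does, both ask whether it runs on the u-rail. This equates the outgoing parity of one
  -- block with the incoming parity of the next.
  out-in : ∀ N i {j r k s} → Link N j r k s →
    uses (on u₁ , after) (contract i j r) (contract i k s) ≡
    uses (before , on u₀) (contract (suc i) j r) (contract (suc i) k s)
  out-in N i = go
    where
    uses-sym : ∀ e p q → uses e p q ≡ uses e q p
    uses-sym (e , f) p q = cong bit (∨-comm ((e ≟ˢ p) ∧ (f ≟ˢ q)) _)
    railEnds : ∀ r s → rail r s ≡ true → uses (on u₁ , after) (on r) after ≡ uses (before , on u₀) before (on s)
    railEnds = from-yes (Fin.all? λ r → Fin.all? λ s → (rail r s Bool.≟ true) →-dec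
      (uses (on u₁ , after) (on r) after ≟ uses (before , on u₀) before (on s)))
    vanish-after : ∀ p q → isAfter p ≡ isAfter q → uses (on u₁ , after) p q ≡ 0
    vanish-after = from-yes (allSpots? λ p → allSpots? λ q →
      (isAfter p Bool.≟ isAfter q) →-dec (uses (on u₁ , after) p q ≟ 0))
    vanish-before : ∀ p q → isBefore p ≡ isBefore q → uses (before , on u₀) p q ≡ 0
    vanish-before = from-yes (allSpots? λ p → allSpots? λ q →
      (isBefore p Bool.≟ isBefore q) →-dec (uses (before , on u₀) p q ≟ 0))
    OutIn : ℕ → Site → ℕ → Site → Set
    OutIn j r k s = uses (on u₁ , after) (contract i j r) (contract i k s) ≡
      uses (before , on u₀) (contract (suc i) j r) (contract (suc i) k s)
    same-side : ∀ j r k s → isAfter (contract i j r) ≡ isAfter (contract i k s) → OutIn j r k s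
    same-side j r k s e = trans (vanish-after (contract i j r) (contract i k s) e)
      (sym (vanish-before (contract (suc i) j r) (contract (suc i) k s)
        (trans (isBefore-suc j i r) (trans (cong not e) (sym (isBefore-suc k i s))))))
    upward : ∀ j r s → rail r s ≡ true → OutIn j r (suc j) s
    upward j r s p = side (position j i) (position (suc j) i) refl refl (successive i j)
      where
      away : ∀ {x y} → position j i ≡ x → position (suc j) i ≡ y → isAfter (spot x r) ≡ isAfter (spot y s) → OutIn j r (suc j) s
      away refl refl e = same-side j r (suc j) s e
      side : ∀ x y → position j i ≡ x → position (suc j) i ≡ y → Successive i j x y → OutIn j r (suc j) s
      side _ _ e f bothBefore   = away e f refl
      side _ _ e f bothAfter    = away e f refl
      side _ _ e f (entering _) = away e f refl
      side _ _ _ _ (leaving refl) rewrite position-refl i | position-suc i | position-pred i = railEnds r s p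
    flip : ∀ {j r k s} → OutIn j r k s → OutIn k s j r
    flip {j} {r} {k} {s} e = trans (uses-sym (on u₁ , after) (contract i k s) (contract i j r))
      (trans e (uses-sym (before , on u₀) (contract (suc i) j r) (contract (suc i) k s)))
    go : ∀ {j r k s} → Link N j r k s → OutIn j r k s
    go (within {j} {r} {s} e) = same-side j r j s isAfter-block
      where
      isAfter-block : isAfter (contract i j r) ≡ isAfter (contract i j s)
      isAfter-block with position j i
      ... | less    = refl
      ... | same    = refl
      ... | greater = refl
    go (up {j} {r} {s} p)   = upward j r s p
    go (down {j} {r} {s} p) = flip {j} {s} {suc j} {r} (upward j s r p)

-- The lower bound on the length of a tour.

module TourLength where

  open Ladder
  open EvenCuts
  open Contraction
  open import Data.Bool using (Bool; true; false; _∧_; not)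
  open import Data.Bool.ListAction using (any)
  open import Data.Bool.Properties using (xor-same)
  open import Data.Fin using (zero; fromℕ<)
  open import Data.Fin.Properties using (toℕ-fromℕ<)
  open import Data.List using (List; []; _∷_; _++_; map)
  open import Data.Nat
  open import Data.Nat.ListAction using (sum)
  open import Data.Nat.ListAction.Properties using (sum-++)
  open import Data.Nat.Properties
  open import Data.Nat.Solver using (module +-*-Solver)
  open import Data.Product using (∃; _,_)
  open import Function using (_∘_)
  open import Relation.Binary.PropositionalEquality
  open import Relation.Nullary using (contradiction)
  open import Relation.Nullary.Decidable using (from-yes; True; toWitness)

  pattern uᵢ  = before , on u₀
  pattern vᵢ  = before , on v₀
  pattern uₘ  = on u₀ , on u₁
  pattern vₘ  = on v₀ , on v₁
  pattern uv  = on u₀ , on v₀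
  pattern ud  = on u₁ , on d₁
  pattern vd  = on v₁ , on d₄
  pattern d₁₂ = on d₁ , on d₂
  pattern d₁₃ = on d₁ , on d₃
  pattern d₂₃ = on d₂ , on d₃
  pattern d₂₄ = on d₂ , on d₄
  pattern d₃₄ = on d₃ , on d₄
  pattern uₒ  = on u₁ , after

  rungEdges diamondEdges : List Edge
  rungEdges    = uᵢ ∷ vᵢ ∷ uₘ ∷ vₘ ∷ uv ∷ []
  diamondEdges = ud ∷ vd ∷ d₁₂ ∷ d₁₃ ∷ d₂₃ ∷ d₂₄ ∷ d₃₄ ∷ []

  -- A block is charged for the steps inside it and on the rails into it.
  notAfter stillBefore charged : Spot → Spot → ℕ
  notAfter p q    = bit (not (isAfter p) ∧ not (isAfter q))
  stillBefore p q = bit (isBefore p ∧ isBefore q)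
  charged p q     = bit (not (isAfter p) ∧ not (isAfter q) ∧ not (isBefore p ∧ isBefore q))

  notAfter-split : ∀ p q → notAfter p q ≡ stillBefore p q + charged p q
  notAfter-split = from-yes (allSpots? λ p → allSpots? λ q → notAfter p q ≟ stillBefore p q + charged p q)

  charged-counts : Counts charged (rungEdges ++ diamondEdges)
  charged-counts = from-yes (counts? charged (rungEdges ++ diamondEdges))

  oneOf : List Spot → Spot → Bool
  oneOf ps q = any (_≟ˢ q) ps

  position-greater : ∀ {i j} → i < j → position j i ≡ greater
  position-greater {zero}  (s≤s z≤n) = refl
  position-greater {suc i} (s≤s i<j) = position-greater i<j

  module _ (N : ℕ) (t : TSPTour (ladder N)) where

    open TSPTour t

    project : ℕ → Vertex N → Spot
    project i v = contract i (block N v) (site N v)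

    project-at : ∀ i {j} (j< : j < blocks N) r → project i (at N (fromℕ< j<) r) ≡ contract i j r
    project-at i j< r = cong₂ (contract i) (trans (block-at N (fromℕ< j<) r) (toℕ-fromℕ< j<)) (site-at N (fromℕ< j<) r)

    total : ℕ → (Spot → Spot → ℕ) → ℕ
    total i w = weight (λ x y → w (project i x) (project i y)) start rest

    mult : ℕ → Edge → ℕ
    mult i e = total i (uses e)

    module _ (i : ℕ) (i<N : i < N) where

      middle-block : kind N (suc i) ≡ middle
      middle-block with i ≡ᵇ N in e
      ... | false = refl
      ... | true  = contradiction (≡ᵇ-sound i N e) (<⇒≢ i<N)

      total-counts : ∀ w es → Counts w es → total (suc i) w ≡ sum (map (mult (suc i)) es)
      total-counts w es c = trans (weight-cong (λ {x} {y} xy → c (project (suc i) x) (project (suc i) y)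
          (Link⇒near N (suc i) middle-block (adj⇒Link N {x} {y} xy))) walk)
        (weight-sum (λ e x y → uses e (project (suc i) x) (project (suc i) y)) es start rest)

      -- Needed for positivity of cuts: the tour must have a vertex to visit on either side. Block 0
      -- precedes and block `suc N` follows every middle block.
      inhabited : ∀ p → ∃ λ v → project (suc i) v ≡ p
      inhabited before = at N zero u₀ , refl
      inhabited after  = at N (fromℕ< j<) u₀ ,
        trans (project-at (suc i) j< u₀) (cong (λ p → spot p u₀) (position-greater i<N))
        where
        j< : suc N < blocks N
        j< = ≤-refl
      inhabited (on r) = at N (fromℕ< j<) r ,
        trans (project-at (suc i) j< r) (cong (λ p → spot p r) (position-refl i))
        where
        j< : suc i < blocks N
        j< = s≤s (m≤n⇒m≤1+n i<N)

      -- The walk ends on the side where it starts, so it crosses evenly often; without a crossing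
      -- it would miss the vertices over `p` or over `q`.
      evenCut : ∀ S es p q → S p ≡ true → S q ≡ false → Counts (separates S) es → EvenCut (map (mult (suc i)) es)
      evenCut S es p q Sp Sq c = subst (λ n → evenPositive n ≡ true) (total-counts (separates S) es c)
          (cong₂ (λ x y → x ∧ not y) is-even non-zero)
        where
        S′ : Vertex N → Bool
        S′ = S ∘ project (suc i)
        is-even : even (crossings S′ start rest) ≡ true
        is-even = trans (even-crossings S′ start rest start closed) (cong not (xor-same (S′ start)))
        S-const : crossings S′ start rest ≡ 0 → ∀ p → S p ≡ S′ start
        S-const z p with inhabited p
        ... | v , refl = uncrossed S′ start rest z (visitsAll v)
        non-zero : isZero (crossings S′ start rest) ≡ false
        non-zero with crossings S′ start rest in z
        ... | suc _ = refl
        ... | zero  = contradiction (trans (sym Sp) (trans (S-const z p) (trans (sym (S-const z q)) Sq))) λ ()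

      -- The edges of a cut are given explicitly, and evaluation of the implicit argument confirms
      -- that they are exactly its edges.
      cut : ∀ p ps es {_ : True (counts? (separates (oneOf (p ∷ ps))) es)} →
        oneOf (p ∷ ps) p ≡ true → oneOf (p ∷ ps) after ≡ false → EvenCut (map (mult (suc i)) es)
      cut p ps es {checked} p-in after-out = evenCut (oneOf (p ∷ ps)) es p after p-in after-out (toWitness checked)

      block-cost : 10 + bit (even (mult (suc i) uᵢ)) ≤ bit (even (mult (suc i) uₒ)) + total (suc i) charged
      -- Adding the two cost inequalities puts `6` and the parity term `x` of the diamond link on
      -- both sides.
      block-cost = +-cancelˡ-≤ (6 + x) _ _ (begin
          6 + x + (10 + I)
            ≡⟨ solve 2 (λ x I → con 6 :+ x :+ (con 10 :+ I) := con 10 :+ I :+ x :+ con 6) refl x I ⟩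
          10 + I + x + 6                                    ≤⟨ +-mono-≤ rungs diamond ⟩
          6 + O + sum (map m rungEdges) + (x + sum (map m diamondEdges))
            ≡⟨ solve 4 (λ x O r d → con 6 :+ O :+ r :+ (x :+ d) := con 6 :+ x :+ (O :+ (r :+ d))) refl x O _ _ ⟩
          6 + x + (O + (sum (map m rungEdges) + sum (map m diamondEdges)))
            ≡⟨ cong (λ n → 6 + x + (O + n)) (sym (sum-++ (map m rungEdges) (map m diamondEdges))) ⟩
          6 + x + (O + sum (map m (rungEdges ++ diamondEdges)))
            ≡⟨ cong (λ n → 6 + x + (O + n)) (sym (total-counts charged (rungEdges ++ diamondEdges) charged-counts)) ⟩
          6 + x + (O + total (suc i) charged)               ∎)
        where
        open ≤-Reasoning
        open +-*-Solver
        m = mult (suc i)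
        x = bit (not (even (m ud)))
        I = bit (even (m uᵢ))
        O = bit (even (m uₒ))
        diamond = diamond-cost (m ud) (m vd) (m d₁₂) (m d₁₃) (m d₂₃) (m d₂₄) (m d₃₄)
          (cut (on d₁) [] (ud ∷ d₁₂ ∷ d₁₃ ∷ []) refl refl)
          (cut (on d₂) [] (d₁₂ ∷ d₂₃ ∷ d₂₄ ∷ []) refl refl)
          (cut (on d₃) [] (d₁₃ ∷ d₂₃ ∷ d₃₄ ∷ []) refl refl)
          (cut (on d₄) [] (vd ∷ d₂₄ ∷ d₃₄ ∷ []) refl refl)
          (cut (on d₂) (on d₃ ∷ on d₄ ∷ []) (vd ∷ d₁₂ ∷ d₁₃ ∷ []) refl refl)
          (cut (on d₁) (on d₂ ∷ on d₃ ∷ []) (ud ∷ d₂₄ ∷ d₃₄ ∷ []) refl refl)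
          (cut (on d₁) (on d₂ ∷ on d₃ ∷ on d₄ ∷ []) (ud ∷ vd ∷ []) refl refl)
        rungs = rungs-cost (m uᵢ) (m vᵢ) (m uₘ) (m vₘ) (m uv) (m ud) (m uₒ)
          (cut before [] (uᵢ ∷ vᵢ ∷ []) refl refl)
          (cut before (on u₀ ∷ on v₀ ∷ []) (uₘ ∷ vₘ ∷ []) refl refl)
          (cut (on u₀) [] (uᵢ ∷ uₘ ∷ uv ∷ []) refl refl)
          (cut (on v₀) [] (vᵢ ∷ vₘ ∷ uv ∷ []) refl refl)
          (cut before (on u₀ ∷ []) (vᵢ ∷ uₘ ∷ uv ∷ []) refl refl)
          (cut before (on v₀ ∷ []) (uᵢ ∷ vₘ ∷ uv ∷ []) refl refl)
          (cut (on u₁) [] (uₘ ∷ ud ∷ uₒ ∷ []) refl refl)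

    mult-out-in : ∀ i → mult i uₒ ≡ mult (suc i) uᵢ
    mult-out-in i = weight-cong (λ {x} {y} xy → out-in N i (adj⇒Link N {x} {y} xy)) walk

    total-suc : ∀ i → total (suc i) notAfter ≡ total i notAfter + total (suc i) charged
    total-suc i = trans
      (trans (weight-cong (λ {x} {y} _ → notAfter-split (project (suc i) x) (project (suc i) y)) walk)
        (weight-+ (λ x y → stillBefore (project (suc i) x) (project (suc i) y)) _ start rest))
      (cong (_+ total (suc i) charged) (weight-cong (λ {x} {y} _ → cong₂ (λ p q → bit (p ∧ q))
        (isBefore-suc (block N x) i (site N x)) (isBefore-suc (block N y) i (site N y))) walk))

    -- The steps inside block 0 are given away, so the induction starts from 0 and `i` counts middle
    -- blocks only.
    prefix-cost : ∀ i → i ≤ N → 10 * i ≤ bit (even (mult i uₒ)) + total i notAfter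
    prefix-cost zero    _   = z≤n
    prefix-cost (suc i) i<N = +-cancelˡ-≤ I _ _ (begin
        I + 10 * suc i              ≡⟨ solve 2 (λ I i → I :+ con 10 :* (con 1 :+ i) := con 10 :* i :+ (con 10 :+ I)) refl I i ⟩
        10 * i + (10 + I)           ≤⟨ +-mono-≤ (prefix-cost i (<⇒≤ i<N)) (block-cost i i<N) ⟩
        bit (even (mult i uₒ)) + L + (O + C)
                                    ≡⟨ cong (λ n → bit (even n) + L + (O + C)) (mult-out-in i) ⟩
        I + L + (O + C)             ≡⟨ solve 4 (λ I L O C → I :+ L :+ (O :+ C) := I :+ (O :+ (L :+ C))) refl I L O C ⟩
        I + (O + (L + C))           ≡⟨ cong (λ n → I + (O + n)) (sym (total-suc i)) ⟩
        I + (O + total (suc i) notAfter) ∎)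
      where
      open ≤-Reasoning
      open +-*-Solver
      I = bit (even (mult (suc i) uᵢ))
      O = bit (even (mult (suc i) uₒ))
      L = total i notAfter
      C = total (suc i) charged

    bit≤1 : ∀ x → bit x ≤ 1
    bit≤1 true  = ≤-refl
    bit≤1 false = z≤n

    tour-long : 10 * N ≤ 1 + tourLength (ladder N) t
    tour-long = ≤-trans (prefix-cost N ≤-refl)
      (+-mono-≤ (bit≤1 (even (mult N uₒ))) (weight≤length _ (λ x y → bit≤1 _) start rest))

-- Segments and linear functionals over the rationals.

module Segments where

  open import Data.Integer as ℤ using (ℤ; +_)
  import Data.Integer.Properties as ℤ
  import Data.Nat.Coprimality as ℕ
  open import Data.Product using (_,_; proj₁)
  open import Data.Rational
  open import Data.Rational.Properties
  open import Data.Rational.Unnormalised using (mkℚᵘ)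
  open import Data.Rational.Solver using (module +-*-Solver)
  open import Relation.Binary.PropositionalEquality
  open import Relation.Nullary using (yes; no; contradiction)

  -- Keeps the normalisation of i / 1, a gcd computation, out of the conversion checks.
  abstract

    fromℤ : ℤ → ℚ
    fromℤ i = i / 1

    fromℤ-/1 : ∀ i → fromℤ i ≡ i / 1
    fromℤ-/1 i = refl

    fromℤ-mkℚ : ∀ i → fromℤ i ≡ mkℚ i 0 (ℕ.sym (ℕ.1-coprimeTo ℤ.∣ i ∣))
    fromℤ-mkℚ i = ↥p/↧p≡p (mkℚ i 0 _)

    toℚᵘ-fromℤ : ∀ i → toℚᵘ (fromℤ i) ≡ mkℚᵘ i 0
    toℚᵘ-fromℤ i = cong toℚᵘ (fromℤ-mkℚ i)

    fromℤ-+ : ∀ i j → fromℤ (i ℤ.+ j) ≡ fromℤ i + fromℤ j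
    fromℤ-+ i j rewrite fromℤ-mkℚ i | fromℤ-mkℚ j = cong fromℤ (sym (cong₂ ℤ._+_ (ℤ.*-identityʳ i) (ℤ.*-identityʳ j)))

    fromℤ-* : ∀ i j → fromℤ (i ℤ.* j) ≡ fromℤ i * fromℤ j
    fromℤ-* i j rewrite fromℤ-mkℚ i | fromℤ-mkℚ j = refl

    fromℤ-mono-≤ : ∀ {i j} → i ℤ.≤ j → fromℤ i ≤ fromℤ j
    fromℤ-mono-≤ {i} {j} i≤j rewrite fromℤ-mkℚ i | fromℤ-mkℚ j = *≤* (ℤ.*-monoʳ-≤-nonNeg (+ 1) i≤j)

    fromℤ-mono-< : ∀ {i j} → i ℤ.< j → fromℤ i < fromℤ j
    fromℤ-mono-< {i} {j} i<j rewrite fromℤ-mkℚ i | fromℤ-mkℚ j = *<* (ℤ.*-monoʳ-<-pos (+ 1) i<j)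

    fromℤ-injective : ∀ {i j} → fromℤ i ≡ fromℤ j → i ≡ j
    fromℤ-injective {i} {j} e rewrite fromℤ-mkℚ i | fromℤ-mkℚ j = cong ↥_ e

  form : ℚ → ℚ → Point → ℚ
  form α β (x , y) = α * x + β * y

  form-onSegment : ∀ α β p q z (s : OnSegment p q z) →
    form α β z ≡ (1ℚ - proj₁ s) * form α β p + proj₁ s * form α β q
  form-onSegment α β (px , py) (qx , qy) (_ , _) (t , _ , _ , refl , refl) =
    solve 7 (λ α β t px py qx qy →
      α :* (px :+ t :* (qx :- px)) :+ β :* (py :+ t :* (qy :- py)) :=
      (con 1ℚ :- t) :* (α :* px :+ β :* py) :+ t :* (α :* qx :+ β :* qy)) refl α β t px py qx qy
    where open +-*-Solver

  -- Half-planes are convex.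
  form-above : ∀ α β p q z {κ} → OnSegment p q z → κ ≤ form α β p → κ ≤ form α β q → κ ≤ form α β z
  form-above α β p q z {κ} s@(t , 0≤t , t≤1 , _) κ≤p κ≤q = begin
    κ                                            ≡⟨ solve 2 (λ κ t → κ := (con 1ℚ :- t) :* κ :+ t :* κ) refl κ t ⟩
    (1ℚ - t) * κ + t * κ                         ≤⟨ +-mono-≤ (*-monoˡ-≤-nonNeg (1ℚ - t) κ≤p) (*-monoˡ-≤-nonNeg t κ≤q) ⟩
    (1ℚ - t) * form α β p + t * form α β q       ≡⟨ sym (form-onSegment α β p q z s) ⟩
    form α β z                                   ∎
    where
    open ≤-Reasoning
    open +-*-Solver
    instance
      t≥0 = nonNegative 0≤t
      1-t≥0 = nonNegative (subst (_≤ 1ℚ - t) (+-inverseʳ t) (+-monoˡ-≤ (- t) t≤1))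

  -- The functional decreases strictly from `p` to `q`, so any parameter `t > 0` already gives a
  -- smaller value than at `p`.
  onSegment-maximum : ∀ α β p q z → form α β q < form α β p → form α β p ≤ form α β z → OnSegment p q z → z ≡ p
  onSegment-maximum α β p@(px , py) q@(qx , qy) z q<p p≤z s@(t , 0≤t , _ , zx , zy) with t ≤? 0ℚ
  ... | yes t≤0 = cong₂ _,_ (trans zx (collapse px (qx - px))) (trans zy (collapse py (qy - py)))
    where
    collapse : ∀ x y → x + t * y ≡ x
    collapse x y rewrite ≤-antisym t≤0 0≤t | *-zeroˡ y = +-identityʳ x
  ... | no t≰0 = contradiction refl (<⇒≢ (<-≤-trans (begin-strict
      form α β z                                ≡⟨ form-onSegment α β p q z s ⟩
      (1ℚ - t) * form α β p + t * form α β q    <⟨ +-monoʳ-< ((1ℚ - t) * form α β p) (*-monoʳ-<-pos t q<p) ⟩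
      (1ℚ - t) * form α β p + t * form α β p    ≡⟨ solve 2 (λ κ t → (con 1ℚ :- t) :* κ :+ t :* κ := κ) refl (form α β p) t ⟩
      form α β p                                ∎) p≤z))
    where
    open ≤-Reasoning
    open +-*-Solver
    instance
      t>0 = positive (≰⇒> t≰0)

  onSegment-reverse : ∀ {p q z} → OnSegment p q z → OnSegment q p z
  onSegment-reverse {px , py} {qx , qy} (t , 0≤t , t≤1 , refl , refl) =
    1ℚ - t , subst (_≤ 1ℚ - t) (+-inverseʳ t) (+-monoˡ-≤ (- t) t≤1) ,
    ≤-trans (+-monoʳ-≤ 1ℚ (neg-antimono-≤ 0≤t)) (≤-reflexive (+-identityʳ 1ℚ)) , reparam px qx , reparam py qy
    where
    open +-*-Solver
    reparam : ∀ x y → x + t * (y - x) ≡ y + (1ℚ - t) * (x - y)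
    reparam x y = solve 3 (λ x y t → x :+ t :* (y :- x) := y :+ (con 1ℚ :- t) :* (x :- y)) refl x y t

-- A planar straight-line drawing of the ladder.

module Drawing where

  open Ladder
  open Segments
  open import Data.Bool using (true)
  open import Data.Bool.Properties as Bool using ()
  open import Data.Fin.Properties as Fin using ()
  open import Data.Integer as ℤ using (ℤ; +_; -[1+_])
  import Data.Integer.Properties as ℤ
  open import Data.Integer.Solver using (module +-*-Solver)
  open import Data.List using (List; []; _∷_)
  open import Data.List.Membership.Propositional using (_∈_)
  open import Data.List.Relation.Unary.All as All using (All)
  open import Data.List.Relation.Unary.Any using (Any; satisfied; any?)
  open import Data.Nat as ℕ using (ℕ; _+_; _*_; _<_)
  import Data.Nat.Properties as ℕ
  open import Data.Nat.Solver renaming (module +-*-Solver to ℕ-Solver)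
  open import Data.Product as Product using (∃; _×_; _,_; proj₁; proj₂)
  open import Data.Product.Properties using (≡-dec; ,-injective)
  open import Data.Rational using (0ℚ; 1ℚ) renaming (_<_ to _<ℚ_; _≤_ to _≤ℚ_)
  open import Data.Sum as Sum using (_⊎_; inj₁; inj₂; swap; map₁; map₂; [_,_]′)
  open import Relation.Binary using (tri<; tri≈; tri>)
  open import Relation.Binary.PropositionalEquality
  open import Relation.Nullary using (Dec; contradiction)
  open import Relation.Nullary.Decidable using (from-yes; _→-dec_; _×-dec_; _⊎-dec_)

  -- The diamond lies strictly between the rails, at heights 6 and 0, and between the rungs, at
  -- abscissas 0 and 3. Each block is shifted by 4, so that blocks occupy disjoint vertical strips.
  siteX siteY : Site → ℕ
  siteX u₀ = 0
  siteX u₁ = 3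
  siteX v₀ = 0
  siteX v₁ = 3
  siteX d₁ = 2
  siteX d₂ = 1
  siteX d₃ = 2
  siteX d₄ = 2
  siteY u₀ = 6
  siteY u₁ = 6
  siteY v₀ = 0
  siteY v₁ = 0
  siteY d₁ = 5
  siteY d₂ = 3
  siteY d₃ = 3
  siteY d₄ = 1

  Place : Set
  Place = ℕ × Site

  _↑_ : Place → ℕ → Place
  (k , r) ↑ m = k + m , r

  toPoint : Place → Point
  toPoint (j , r) = fromℤ (+ (4 * j + siteX r)) , fromℤ (+ siteY r)

  -- A record, so that the ends can be inferred from its type.
  record On (p q : Place) (z : Point) : Set where
    constructor on
    field onSegment : OnSegment (toPoint p) (toPoint q) z

  reversed : ∀ {p q z} → On p q z → On q p z
  reversed {p} {q} {z} (on z∈) = on (onSegment-reverse {toPoint p} {toPoint q} {z} z∈)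

  Form : Set
  Form = ℤ × ℤ

  value : Form → Place → ℤ
  value (α , β) (j , r) = α ℤ.* + (4 * j + siteX r) ℤ.+ β ℤ.* + siteY r

  drift : Form → ℕ → ℤ
  drift (α , _) m = α ℤ.* + (4 * m)

  abscissa-↑ : ∀ k m x → 4 * (k + m) + x ≡ 4 * k + x + 4 * m
  abscissa-↑ = solve 3 (λ k m x → con 4 :* (k :+ m) :+ x := con 4 :* k :+ x :+ con 4 :* m) refl
    where open ℕ-Solver

  value-↑ : ∀ φ p m → value φ (p ↑ m) ≡ value φ p ℤ.+ drift φ m
  value-↑ (α , β) (k , r) m = begin
    α ℤ.* + (4 * (k + m) + siteX r) ℤ.+ Y
      ≡⟨ cong (λ n → α ℤ.* n ℤ.+ Y) (trans (cong +_ (abscissa-↑ k m (siteX r))) (ℤ.pos-+ (4 * k + siteX r) (4 * m))) ⟩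
    α ℤ.* (+ (4 * k + siteX r) ℤ.+ + (4 * m)) ℤ.+ Y
      ≡⟨ solve 4 (λ α x y m → α :* (x :+ m) :+ y := α :* x :+ y :+ α :* m) refl α (+ (4 * k + siteX r)) Y (+ (4 * m)) ⟩
    value (α , β) (k , r) ℤ.+ drift (α , β) m         ∎
    where
    open ≡-Reasoning
    open +-*-Solver
    Y = β ℤ.* + siteY r

  -- If both ends c and d of a second segment satisfy Peak φ p q, then the
  -- segments pq and cd can meet only at p.
  Peak : Form → Place → Place → Place → Set
  Peak φ p q c = value φ q ℤ.< value φ p × value φ p ℤ.≤ value φ c

  peak? : ∀ φ p q c → Dec (Peak φ p q c)
  peak? φ p q c = value φ q ℤ.<? value φ p ×-dec value φ p ℤ.≤? value φ c

  peak-↑ : ∀ φ p q c m → Peak φ p q c → Peak φ (p ↑ m) (q ↑ m) (c ↑ m)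
  peak-↑ φ p q c m (q<p , p≤c) rewrite value-↑ φ p m | value-↑ φ q m | value-↑ φ c m =
    ℤ.+-monoˡ-< (drift φ m) q<p , ℤ.+-monoˡ-≤ (drift φ m) p≤c

  -- Moving `c` to the right cannot lower a functional with nonnegative first coefficient, so a
  -- check against one block covers all later ones.
  peak-later : ∀ φ p q c m → + 0 ℤ.≤ proj₁ φ → Peak φ p q c → Peak φ p q (c ↑ m)
  peak-later φ p q c m α≥0 (q<p , p≤c) = q<p , ℤ.≤-trans p≤c (ℤ.≤-trans (ℤ.≤-reflexive (sym (ℤ.+-identityʳ _)))
    (ℤ.≤-trans (ℤ.+-monoʳ-≤ (value φ c) (ℤ.*-monoʳ-≤-nonNeg (+ (4 * m)) α≥0)) (ℤ.≤-reflexive (sym (value-↑ φ c m)))))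

  peak-earlier : ∀ φ p q c m → proj₁ φ ℤ.≤ + 0 → Peak φ p q c → Peak φ (p ↑ m) (q ↑ m) c
  peak-earlier φ p q c m α≤0 (q<p , p≤c) rewrite value-↑ φ p m | value-↑ φ q m =
    ℤ.+-monoˡ-< (drift φ m) q<p ,
    ℤ.≤-trans (ℤ.+-monoʳ-≤ (value φ p) (ℤ.*-monoʳ-≤-nonNeg (+ (4 * m)) α≤0))
      (ℤ.≤-trans (ℤ.≤-reflexive (ℤ.+-identityʳ _)) p≤c)

  form-toPoint : ∀ α β p → form (fromℤ α) (fromℤ β) (toPoint p) ≡ fromℤ (value (α , β) p)
  form-toPoint α β (j , r) = sym (trans (fromℤ-+ (α ℤ.* _) (β ℤ.* _)) (cong₂ Data.Rational._+_ (fromℤ-* α _) (fromℤ-* β _)))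

  module _ {p q : Place} {z : Point} (z∈pq : OnSegment (toPoint p) (toPoint q) z) where

    -- By convexity `z` has at least the value at `p`, and on `pq` only `p` attains it.
    peak-meets : ∀ φ c d → Peak φ p q c → Peak φ p q d → OnSegment (toPoint c) (toPoint d) z → z ≡ toPoint p
    peak-meets φ@(α , β) c d (q<p , p≤c) (_ , p≤d) z∈cd =
      onSegment-maximum (fromℤ α) (fromℤ β) (toPoint p) (toPoint q) z
      (subst₂ _<ℚ_ (sym (form-toPoint α β q)) (sym (form-toPoint α β p)) (fromℤ-mono-< q<p))
      (form-above (fromℤ α) (fromℤ β) (toPoint c) (toPoint d) z z∈cd (below c p≤c) (below d p≤d)) z∈pq
      where
      below : ∀ c → value φ p ℤ.≤ value φ c →
        form (fromℤ α) (fromℤ β) (toPoint p) ≤ℚ form (fromℤ α) (fromℤ β) (toPoint c)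
      below c p≤c = subst₂ _≤ℚ_ (sym (form-toPoint α β p)) (sym (form-toPoint α β c)) (fromℤ-mono-≤ p≤c)

  onSegment-start : ∀ p q → OnSegment p q p
  onSegment-start (px , py) (qx , qy) = 0ℚ , ≤-refl , from-yes (0ℚ ≤? 1ℚ) , collapse px (qx - px) , collapse py (qy - py)
    where
    open import Data.Rational using (_-_) renaming (_+_ to _+ℚ_; _*_ to _*ℚ_)
    open import Data.Rational.Properties
    collapse : ∀ x y → x ≡ x +ℚ 0ℚ *ℚ y
    collapse x y rewrite *-zeroˡ y = sym (+-identityʳ x)

  -- The edge (r , δ , s) joins site r of some block j to site s of block δ + j.
  BaseEdge : Set
  BaseEdge = Site × Place

  src tgt : BaseEdge → Place
  src (r , _) = 0 , r
  tgt (_ , p) = p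

  -- The union of the edges of all kinds of blocks is still drawn without crossings.
  baseEdges : List BaseEdge
  baseEdges =
    (u₀ , 0 , u₁) ∷ (v₀ , 0 , v₁) ∷ (u₀ , 0 , v₀) ∷ (u₁ , 0 , v₁) ∷
    (d₁ , 0 , d₂) ∷ (d₁ , 0 , d₃) ∷ (d₂ , 0 , d₃) ∷ (d₂ , 0 , d₄) ∷ (d₃ , 0 , d₄) ∷
    (u₀ , 0 , d₁) ∷ (v₀ , 0 , d₄) ∷ (u₁ , 0 , d₁) ∷ (v₁ , 0 , d₄) ∷
    (u₁ , 1 , u₀) ∷ (v₁ , 1 , v₀) ∷ []

  _≟ᵇ_ : (e f : BaseEdge) → Dec (e ≡ f)
  _≟ᵇ_ = ≡-dec Fin._≟_ (≡-dec ℕ._≟_ Fin._≟_)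

  open import Data.List.Membership.DecPropositional _≟ᵇ_ using (_∈?_)

  -- Found by a computer search: they separate whatever has to be separated.
  forms : List Form
  forms = (-[1+ 2 ] , -[1+ 1 ]) ∷ (+ 6 , -[1+ 0 ]) ∷ (-[1+ 0 ] , + 3) ∷
    (-[1+ 5 ] , -[1+ 0 ]) ∷ (+ 1 , + 3) ∷ (+ 1 , -[1+ 0 ]) ∷ []

  Pair : Form → (p q c d : Place) → Set
  Pair φ p q c d = Peak φ p q c × Peak φ p q d

  pair? : ∀ φ p q c d → Dec (Pair φ p q c d)
  pair? φ p q c d = peak? φ p q c ×-dec peak? φ p q d

  Apart : (p q c d : Place) → Set
  Apart p q c d = Any (λ φ → (Pair φ p q c d ⊎ Pair φ q p c d) ⊎ (Pair φ c d p q ⊎ Pair φ d c p q)) forms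

  abstract

    apart : All (λ e → All (λ f → e ≡ f ⊎ Apart (src e) (tgt e) (src f) (tgt f)) baseEdges) baseEdges
    apart = from-yes (All.all? (λ e → All.all? (λ f → e ≟ᵇ f ⊎-dec any? (λ φ →
      (pair? φ (src e) (tgt e) (src f) (tgt f) ⊎-dec pair? φ (tgt e) (src e) (src f) (tgt f)) ⊎-dec
      (pair? φ (src f) (tgt f) (src e) (tgt e) ⊎-dec pair? φ (tgt f) (src f) (src e) (tgt e))) forms) baseEdges) baseEdges)

    apart-sites : All (λ e → ∀ r →
      Any (λ φ → Peak φ (src e) (tgt e) (0 , r) ⊎ Peak φ (tgt e) (src e) (0 , r)) forms) baseEdges
    apart-sites = from-yes (All.all? (λ e → Fin.all? λ r →
      any? (λ φ → peak? φ (src e) (tgt e) (0 , r) ⊎-dec peak? φ (tgt e) (src e) (0 , r)) forms) baseEdges)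

    -- One functional has to serve all sites of the next block at once. It then also handles rails
    -- of later blocks, whose ends lie in different blocks.
    apart-later : All (λ e → Any (λ φ → + 0 ℤ.≤ proj₁ φ ×
      ((∀ r → Peak φ (src e) (tgt e) (1 , r)) ⊎ (∀ r → Peak φ (tgt e) (src e) (1 , r)))) forms) baseEdges
    apart-later = from-yes (All.all? (λ e → any? (λ φ → + 0 ℤ.≤? proj₁ φ ×-dec
      (Fin.all? (λ r → peak? φ (src e) (tgt e) (1 , r)) ⊎-dec Fin.all? (λ r → peak? φ (tgt e) (src e) (1 , r)))) forms) baseEdges)

    -- Two edges based in different blocks are treated from the earlier one; this mirrored check is
    -- for a vertex that lies in a block before the edge.
    apart-earlier : All (λ e → Any (λ φ → proj₁ φ ℤ.≤ + 0 ×
      ((∀ r → Peak φ (src e ↑ 1) (tgt e ↑ 1) (0 , r)) ⊎ (∀ r → Peak φ (tgt e ↑ 1) (src e ↑ 1) (0 , r)))) forms) baseEdges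
    apart-earlier = from-yes (All.all? (λ e → any? (λ φ → proj₁ φ ℤ.≤? + 0 ×-dec
      (Fin.all? (λ r → peak? φ (src e ↑ 1) (tgt e ↑ 1) (0 , r)) ⊎-dec
       Fin.all? (λ r → peak? φ (tgt e ↑ 1) (src e ↑ 1) (0 , r)))) forms) baseEdges)

  pair-meets : ∀ {z} j φ p q c d → Pair φ p q c d → On (p ↑ j) (q ↑ j) z →
    On (c ↑ j) (d ↑ j) z → z ≡ toPoint (p ↑ j)
  pair-meets j φ p q c d (pc , pd) (on z∈pq) (on z∈cd) =
    peak-meets {p ↑ j} {q ↑ j} z∈pq φ (c ↑ j) (d ↑ j) (peak-↑ φ p q c j pc) (peak-↑ φ p q d j pd) z∈cd

  EndOf : Point → Place → Place → Set
  EndOf z p q = z ≡ toPoint p ⊎ z ≡ toPoint q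

  OnEdge : BaseEdge → ℕ → Point → Set
  OnEdge e j z = On (src e ↑ j) (tgt e ↑ j) z

  IsEnd : Point → BaseEdge → ℕ → Set
  IsEnd z e j = EndOf z (src e ↑ j) (tgt e ↑ j)

  apart-meets : ∀ {z} j p q c d → Apart p q c d →
    On (p ↑ j) (q ↑ j) z → On (c ↑ j) (d ↑ j) z →
    EndOf z (p ↑ j) (q ↑ j) ⊎ EndOf z (c ↑ j) (d ↑ j)
  apart-meets j p q c d ap z∈pq z∈cd with satisfied ap
  ... | φ , inj₁ (inj₁ pr) = inj₁ (inj₁ (pair-meets j φ p q c d pr z∈pq z∈cd))
  ... | φ , inj₁ (inj₂ pr) = inj₁ (inj₂ (pair-meets j φ q p c d pr (reversed z∈pq) z∈cd))
  ... | φ , inj₂ (inj₁ pr) = inj₂ (inj₁ (pair-meets j φ c d p q pr z∈cd z∈pq))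
  ... | φ , inj₂ (inj₂ pr) = inj₂ (inj₂ (pair-meets j φ d c p q pr (reversed z∈cd) z∈pq))

  later-meets : ∀ {z e} j → e ∈ baseEdges → OnEdge e j z → ∀ r m s n →
    On (((1 , r) ↑ m) ↑ j) (((1 , s) ↑ n) ↑ j) z → IsEnd z e j
  later-meets {z} {e} j e∈ z∈e r m s n z∈cd with satisfied (All.lookup apart-later e∈)
  ... | φ , α≥0 , inj₁ pk = inj₁ (pair-meets j φ (src e) (tgt e) ((1 , r) ↑ m) ((1 , s) ↑ n)
    (peak-later φ (src e) (tgt e) (1 , r) m α≥0 (pk r) , peak-later φ (src e) (tgt e) (1 , s) n α≥0 (pk s)) z∈e z∈cd)
  ... | φ , α≥0 , inj₂ pk = inj₂ (pair-meets j φ (tgt e) (src e) ((1 , r) ↑ m) ((1 , s) ↑ n)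
    (peak-later φ (tgt e) (src e) (1 , r) m α≥0 (pk r) , peak-later φ (tgt e) (src e) (1 , s) n α≥0 (pk s)) (reversed z∈e) z∈cd)

  later-edges : ∀ {z e f} j m → e ∈ baseEdges → OnEdge e j z → OnEdge f (1 + m + j) z → IsEnd z e j
  later-edges {z} {e} {r , δ , s} j m e∈ z∈e z∈f = later-meets {e = e} j e∈ z∈e r m s (δ + m)
    (subst (λ k → On (1 + m + j , r) (k , s) z) (shift δ) z∈f)
    where
    shift : ∀ δ → δ + (1 + m + j) ≡ 1 + (δ + m) + j
    shift δ = trans (ℕ.+-suc δ (m + j)) (cong ℕ.suc (sym (ℕ.+-assoc δ m j)))

  -- A vertex is regarded as a degenerate segment, so that a vertex on an edge becomes a case of two
  -- segments that meet.
  on-point : ∀ p → On p p (toPoint p)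
  on-point p = on (onSegment-start (toPoint p) (toPoint p))

  later-site : ∀ {e} j m r → e ∈ baseEdges → OnEdge e j (toPoint (1 + m + j , r)) → IsEnd (toPoint (1 + m + j , r)) e j
  later-site {e} j m r e∈ z∈e = later-meets {e = e} j e∈ z∈e r m r m (on-point (1 + m + j , r))

  same-site : ∀ {e} j r → e ∈ baseEdges → OnEdge e j (toPoint (j , r)) → IsEnd (toPoint (j , r)) e j
  same-site {e} j r e∈ z∈e with satisfied (All.lookup apart-sites e∈ r)
  ... | φ , inj₁ pk = inj₁ (pair-meets j φ (src e) (tgt e) (0 , r) (0 , r) (pk , pk) z∈e (on-point (j , r)))
  ... | φ , inj₂ pk = inj₂ (pair-meets j φ (tgt e) (src e) (0 , r) (0 , r) (pk , pk) (reversed z∈e) (on-point (j , r)))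

  earlier-site : ∀ {e} k m r → e ∈ baseEdges → OnEdge e (1 + m + k) (toPoint (k , r)) → IsEnd (toPoint (k , r)) e (1 + m + k)
  earlier-site {e@(_ , δ , s)} k m r e∈ z∈e = subst (λ n → EndOf z (1 + m + k , proj₁ e) (n , s)) (sym (shift δ))
      (meets (satisfied (All.lookup apart-earlier e∈))
        (subst (λ n → On (1 + m + k , proj₁ e) (n , s) z) (shift δ) z∈e))
    where
    z = toPoint (k , r)
    p = (src e ↑ 1) ↑ m
    q = (tgt e ↑ 1) ↑ m
    shift : ∀ δ → δ + (1 + m + k) ≡ δ + 1 + m + k
    shift δ = trans (sym (ℕ.+-assoc δ (1 + m) k)) (cong (_+ k) (sym (ℕ.+-assoc δ 1 m)))
    meets : (∃ λ φ → proj₁ φ ℤ.≤ + 0 ×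
        ((∀ r → Peak φ (src e ↑ 1) (tgt e ↑ 1) (0 , r)) ⊎ (∀ r → Peak φ (tgt e ↑ 1) (src e ↑ 1) (0 , r)))) →
      On (p ↑ k) (q ↑ k) z → EndOf z (p ↑ k) (q ↑ k)
    meets (φ , α≤0 , inj₁ pk) z∈ = inj₁ (pair-meets k φ p q (0 , r) (0 , r) (peak , peak) z∈ (on-point (k , r)))
      where peak = peak-earlier φ (src e ↑ 1) (tgt e ↑ 1) (0 , r) m α≤0 (pk r)
    meets (φ , α≤0 , inj₂ pk) z∈ = inj₂ (pair-meets k φ q p (0 , r) (0 , r) (peak , peak) (reversed z∈) (on-point (k , r)))
      where peak = peak-earlier φ (tgt e ↑ 1) (src e ↑ 1) (0 , r) m α≤0 (pk r)

  <⇒gap : ∀ {j k} → j < k → ∃ λ m → k ≡ 1 + m + j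
  <⇒gap {j} j<k with ℕ.m≤n⇒∃[o]m+o≡n j<k
  ... | m , refl = m , cong ℕ.suc (ℕ.+-comm j m)

  site-on-edge : ∀ {e} j w → e ∈ baseEdges → OnEdge e j (toPoint w) → IsEnd (toPoint w) e j
  site-on-edge {e} j (k , r) e∈ z∈e with ℕ.<-cmp j k
  ... | tri≈ _ refl _ = same-site {e} j r e∈ z∈e
  ... | tri< j<k _ _ with m , refl ← <⇒gap j<k = later-site {e} j m r e∈ z∈e
  ... | tri> _ _ k<j with m , refl ← <⇒gap k<j = earlier-site {e} k m r e∈ z∈e

  edges-meet : ∀ {e f z} j k → e ∈ baseEdges → f ∈ baseEdges → OnEdge e j z → OnEdge f k z →
    (e ≡ f × j ≡ k) ⊎ (IsEnd z e j ⊎ IsEnd z f k)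
  edges-meet {e} {f} j k e∈ f∈ z∈e z∈f with ℕ.<-cmp j k
  ... | tri< j<k _ _ with m , refl ← <⇒gap j<k = inj₂ (inj₁ (later-edges {e = e} {f} j m e∈ z∈e z∈f))
  ... | tri> _ _ k<j with m , refl ← <⇒gap k<j = inj₂ (inj₂ (later-edges {e = f} {e} k m f∈ z∈f z∈e))
  ... | tri≈ _ refl _ with All.lookup (All.lookup apart e∈) f∈
  ...   | inj₁ e≡f = inj₁ (e≡f , refl)
  ...   | inj₂ ap  = inj₂ (apart-meets j (src e) (tgt e) (src f) (tgt f) ap z∈e z∈f)

  abstract

    inner⇒baseEdge : ∀ k r s → inner k r s ≡ true → (r , 0 , s) ∈ baseEdges ⊎ (s , 0 , r) ∈ baseEdges
    inner⇒baseEdge = from-yes (allKinds? λ k → Fin.all? λ r → Fin.all? λ s →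
      (inner k r s Bool.≟ true) →-dec ((r , 0 , s) ∈? baseEdges ⊎-dec (s , 0 , r) ∈? baseEdges))

    rail⇒baseEdge : ∀ r s → rail r s ≡ true → (r , 1 , s) ∈ baseEdges
    rail⇒baseEdge = from-yes (Fin.all? λ r → Fin.all? λ s → (rail r s Bool.≟ true) →-dec ((r , 1 , s) ∈? baseEdges))

  data Drawn : Place → Place → Set where
    forward  : ∀ {e} j → e ∈ baseEdges → Drawn (src e ↑ j) (tgt e ↑ j)
    backward : ∀ {e} j → e ∈ baseEdges → Drawn (tgt e ↑ j) (src e ↑ j)

  Link⇒Drawn : ∀ N {j r k s} → Link N j r k s → Drawn (j , r) (k , s)
  Link⇒Drawn N (within {j} {r} {s} i) with inner⇒baseEdge (kind N j) r s i
  ... | inj₁ e∈ = forward j e∈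
  ... | inj₂ e∈ = backward j e∈
  Link⇒Drawn N (up {j} {r} {s} p)   = forward j (rail⇒baseEdge r s p)
  Link⇒Drawn N (down {j} {r} {s} p) = backward j (rail⇒baseEdge s r p)

  Drawn-sites : ∀ {p q} w → Drawn p q → On p q (toPoint w) → EndOf (toPoint w) p q
  Drawn-sites w (forward {e} j e∈)  z∈ = site-on-edge {e} j w e∈ z∈
  Drawn-sites w (backward {e} j e∈) z∈ = swap (site-on-edge {e} j w e∈ (reversed z∈))

  Drawn-meet : ∀ {p q c d z} → Drawn p q → Drawn c d →
    On p q z → On c d z →
    ((p ≡ c × q ≡ d) ⊎ (p ≡ d × q ≡ c)) ⊎ (EndOf z p q ⊎ EndOf z c d)
  Drawn-meet (forward {e} j e∈) (forward {f} k f∈) z∈e z∈f with edges-meet {e} {f} j k e∈ f∈ z∈e z∈f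
  ... | inj₁ (refl , refl) = inj₁ (inj₁ (refl , refl))
  ... | inj₂ ends          = inj₂ ends
  Drawn-meet (forward {e} j e∈) (backward {f} k f∈) z∈e z∈f with edges-meet {e} {f} j k e∈ f∈ z∈e (reversed z∈f)
  ... | inj₁ (refl , refl) = inj₁ (inj₂ (refl , refl))
  ... | inj₂ ends          = inj₂ (map₂ swap ends)
  Drawn-meet (backward {e} j e∈) (forward {f} k f∈) z∈e z∈f with edges-meet {e} {f} j k e∈ f∈ (reversed z∈e) z∈f
  ... | inj₁ (refl , refl) = inj₁ (inj₂ (refl , refl))
  ... | inj₂ ends          = inj₂ (map₁ swap ends)
  Drawn-meet (backward {e} j e∈) (backward {f} k f∈) z∈e z∈f with edges-meet {e} {f} j k e∈ f∈ (reversed z∈e) (reversed z∈f)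
  ... | inj₁ (refl , refl) = inj₁ (inj₁ (refl , refl))
  ... | inj₂ ends          = inj₂ (Sum.map swap swap ends)

  abstract

    siteX<4 : ∀ r → siteX r < 4
    siteX<4 = from-yes (Fin.all? λ r → siteX r ℕ.<? 4)

    site-injective : ∀ r s → siteX r ≡ siteX s → siteY r ≡ siteY s → r ≡ s
    site-injective = from-yes (Fin.all? λ r → Fin.all? λ s →
      (siteX r ℕ.≟ siteX s) →-dec ((siteY r ℕ.≟ siteY s) →-dec (r Fin.≟ s)))

  -- Since `siteX` stays below 4, the abscissa determines the block.
  toPoint-injective : ∀ p q → toPoint p ≡ toPoint q → p ≡ q
  toPoint-injective (j , r) (k , s) e with ,-injective e
  ... | ex , ey = same (ℤ.+-injective (fromℤ-injective ex)) (ℤ.+-injective (fromℤ-injective ey))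
    where
    <⇒≢ : ∀ {j k} r s → j < k → 4 * j + siteX r ≢ 4 * k + siteX s
    <⇒≢ {j} {k} r s j<k = ℕ.<⇒≢ (begin-strict
        4 * j + siteX r  <⟨ ℕ.+-monoʳ-< (4 * j) (siteX<4 r) ⟩
        4 * j + 4        ≡⟨ trans (ℕ.+-comm (4 * j) 4) (sym (ℕ.*-suc 4 j)) ⟩
        4 * ℕ.suc j      ≤⟨ ℕ.*-monoʳ-≤ 4 j<k ⟩
        4 * k            ≤⟨ ℕ.m≤m+n (4 * k) (siteX s) ⟩
        4 * k + siteX s  ∎)
      where open ℕ.≤-Reasoning
    same : 4 * j + siteX r ≡ 4 * k + siteX s → siteY r ≡ siteY s → (j , r) ≡ (k , s)
    same x y with ℕ.<-cmp j k
    ... | tri< j<k _ _ = contradiction x (<⇒≢ r s j<k)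
    ... | tri> _ _ k<j = contradiction (sym x) (<⇒≢ s r k<j)
    ... | tri≈ _ refl _ = cong (j ,_) (site-injective r s (ℕ.+-cancelˡ-≡ (4 * j) _ _ x) y)

  module _ (N : ℕ) where

    place : Vertex N → Place
    place v = block N v , site N v

    place-injective : ∀ {v w} → place v ≡ place w → v ≡ w
    place-injective e = vertex-ext N (proj₁ (,-injective e)) (proj₂ (,-injective e))

    position : Vertex N → Point
    position v = toPoint (place v)

    adj⇒Drawn : ∀ v w → Adj (ladder N) v w → Drawn (place v) (place w)
    adj⇒Drawn v w vw = Link⇒Drawn N (adj⇒Link N {v} {w} vw)

    ladder-planar : Planar (ladder N)
    ladder-planar = position ,
        (λ v w e → injective v w e) ,
        (λ w v v′ vv′ z∈ → Sum.map (injective w v) (injective w v′) (Drawn-sites (place w) (adj⇒Drawn v v′ vv′) (on z∈))) ,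
        λ v v′ w w′ vv′ ww′ z z∈v z∈w → Sum.map
          (Sum.map (Product.map place-injective place-injective) (Product.map place-injective place-injective))
          [ [ v ,_ , v′ ,_ ]′ , [ w ,_ , w′ ,_ ]′ ]′
          (Drawn-meet (adj⇒Drawn v v′ vv′) (adj⇒Drawn w w′ ww′) (on z∈v) (on z∈w))
      where
      injective : ∀ v w → position v ≡ position w → v ≡ w
      injective v w e = place-injective {v} {w} (toPoint-injective (place v) (place w) e)

-- From the additive bound to the factor 5/4 - ε.

module Estimate where

  open Segments
  open import Data.Nat as ℕ using (ℕ; suc)
  import Data.Nat.Properties as ℕ
  open import Data.Nat.Solver renaming (module +-*-Solver to ℕ-Solver)
  open import Data.Integer as ℤ using (ℤ; +_; +[1+_])
  import Data.Integer.Properties as ℤ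
  open import Data.Rational
  open import Data.Rational.Properties
  open import Data.Rational.Unnormalised as ℚᵘ using (mkℚᵘ)
  import Data.Rational.Unnormalised.Properties as ℚᵘ
  open import Data.Rational.Solver using (module +-*-Solver)
  open import Relation.Binary.PropositionalEquality

  -- A tour of 2 + N blocks may fall short of 10 edges per block by 21, so ε n ≥ 21 is
  -- needed for n = 8 (2 + N); note that ε ≥ 1 / ↧ₙ ε.
  blocks-for : ℚ → ℕ
  blocks-for ε = 3 ℕ.* ↧ₙ ε

  -- This is `21 ≤ ε n` cross-multiplied for `ε = suc p / q`, the factors 1 being denominators of
  -- integers. The 3 in `blocks-for` suffices because 8 * 3 ≥ 21.
  slack-bound : ∀ q p → 21 ℕ.* (q ℕ.* 1) ℕ.≤ suc p ℕ.* ((2 ℕ.+ 3 ℕ.* q) ℕ.* 8) ℕ.* 1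
  slack-bound q p = begin
    21 ℕ.* (q ℕ.* 1)                                                ≤⟨ ℕ.m≤m+n _ (16 ℕ.+ 3 ℕ.* q ℕ.+ p ℕ.* n) ⟩
    21 ℕ.* (q ℕ.* 1) ℕ.+ (16 ℕ.+ 3 ℕ.* q ℕ.+ p ℕ.* n)
      ≡⟨ solve 3 (λ q p n → con 21 :* (q :* con 1) :+ (con 16 :+ con 3 :* q :+ p :* n) :=
                            (con 2 :+ con 3 :* q) :* con 8 :+ p :* n) refl q p n ⟩
    suc p ℕ.* n                                                     ≡⟨ sym (ℕ.*-identityʳ (suc p ℕ.* n)) ⟩
    suc p ℕ.* n ℕ.* 1                                               ∎
    where
    open ℕ.≤-Reasoning
    open ℕ-Solver
    n = (2 ℕ.+ 3 ℕ.* q) ℕ.* 8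

  slack : ∀ ε → 0ℚ < ε → fromℤ (+ 21) ≤ ε * fromℤ (+ ((2 ℕ.+ blocks-for ε) ℕ.* 8))
  slack ε@(mkℚ +[1+ p ] d _) _ = toℚᵘ-cancel-≤ (begin
    toℚᵘ (fromℤ (+ 21))                 ≡⟨ toℚᵘ-fromℤ (+ 21) ⟩
    mkℚᵘ (+ 21) 0                       ≤⟨ ℚᵘ.*≤* (ℤ.+≤+ (slack-bound (suc d) p)) ⟩
    toℚᵘ ε ℚᵘ.* mkℚᵘ (+ n) 0            ≡⟨ cong (toℚᵘ ε ℚᵘ.*_) (sym (toℚᵘ-fromℤ (+ n))) ⟩
    toℚᵘ ε ℚᵘ.* toℚᵘ (fromℤ (+ n))      ≃⟨ ℚᵘ.≃-sym (toℚᵘ-homo-* ε (fromℤ (+ n))) ⟩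
    toℚᵘ (ε * fromℤ (+ n))              ∎)
    where
    open ℚᵘ.≤-Reasoning
    n = (2 ℕ.+ blocks-for ε) ℕ.* 8
  slack (mkℚ (+ 0) _ _) (*<* (ℤ.+<+ ()))
  slack (mkℚ ℤ.-[1+ _ ] _ _) (*<* ())

  five-quarters : ∀ m → (+ 5) / 4 * fromℤ (+ (m ℕ.* 8)) ≡ fromℤ (+ (10 ℕ.* m))
  five-quarters m = begin
    (+ 5) / 4 * fromℤ (+ (m ℕ.* 8))
      ≡⟨ cong (λ i → (+ 5) / 4 * fromℤ i) (trans (cong +_ (ℕ.*-comm m 8)) (ℤ.pos-* 8 m)) ⟩
    (+ 5) / 4 * fromℤ (+ 8 ℤ.* + m)                ≡⟨ cong ((+ 5) / 4 *_) (fromℤ-* (+ 8) (+ m)) ⟩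
    (+ 5) / 4 * (fromℤ (+ 8) * fromℤ (+ m))        ≡⟨ sym (*-assoc ((+ 5) / 4) (fromℤ (+ 8)) (fromℤ (+ m))) ⟩
    (+ 5) / 4 * fromℤ (+ 8) * fromℤ (+ m)          ≡⟨ cong (λ x → (+ 5) / 4 * x * fromℤ (+ m)) (fromℤ-/1 (+ 8)) ⟩
    (+ 10) / 1 * fromℤ (+ m)                       ≡⟨ cong (_* fromℤ (+ m)) (sym (fromℤ-/1 (+ 10))) ⟩
    fromℤ (+ 10) * fromℤ (+ m)                     ≡⟨ sym (fromℤ-* (+ 10) (+ m)) ⟩
    fromℤ (+ 10 ℤ.* + m)                           ≡⟨ cong fromℤ (sym (ℤ.pos-* 10 m)) ⟩
    fromℤ (+ (10 ℕ.* m))                           ∎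
    where open ≡-Reasoning

  estimate : ∀ ε → 0ℚ < ε → ∀ ℓ → 10 ℕ.* blocks-for ε ℕ.≤ 1 ℕ.+ ℓ →
    ((+ 5) / 4 - ε) * ((+ ((2 ℕ.+ blocks-for ε) ℕ.* 8)) / 1) ≤ (+ ℓ) / 1
  estimate ε ε>0 ℓ long = begin
    ((+ 5) / 4 - ε) * ((+ n) / 1)                  ≡⟨ cong (((+ 5) / 4 - ε) *_) (sym (fromℤ-/1 (+ n))) ⟩
    ((+ 5) / 4 - ε) * fromℤ (+ n)
      ≡⟨ solve 3 (λ x y z → (x :- y) :* z := x :* z :- y :* z) refl ((+ 5) / 4) ε (fromℤ (+ n)) ⟩
    (+ 5) / 4 * fromℤ (+ n) - ε * fromℤ (+ n)      ≤⟨ +-mono-≤ upper (neg-antimono-≤ (slack ε ε>0)) ⟩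
    fromℤ (+ ℓ) + fromℤ (+ 21) - fromℤ (+ 21)      ≡⟨ solve 2 (λ x y → x :+ y :- y := x) refl (fromℤ (+ ℓ)) (fromℤ (+ 21)) ⟩
    fromℤ (+ ℓ)                                    ≡⟨ fromℤ-/1 (+ ℓ) ⟩
    (+ ℓ) / 1                                      ∎
    where
    open ≤-Reasoning
    open +-*-Solver
    N = blocks-for ε
    n = (2 ℕ.+ N) ℕ.* 8
    -- The 21 consists of 10 for each of the two end blocks and 1 for the parity term left over by
    -- the telescoping.
    long′ : 10 ℕ.* (2 ℕ.+ N) ℕ.≤ ℓ ℕ.+ 21
    long′ = ℕ.≤-trans (ℕ.≤-reflexive (ℕ.*-distribˡ-+ 10 2 N)) (ℕ.≤-trans (ℕ.+-monoʳ-≤ 20 long)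
      (ℕ.≤-reflexive (ℕ.+-comm 21 ℓ)))
    upper : (+ 5) / 4 * fromℤ (+ n) ≤ fromℤ (+ ℓ) + fromℤ (+ 21)
    upper = ≤-trans (≤-reflexive (five-quarters (2 ℕ.+ N))) (≤-trans (fromℤ-mono-≤ (ℤ.+≤+ long′))
      (≤-reflexive (trans (cong fromℤ (ℤ.pos-+ ℓ 21)) (fromℤ-+ (+ ℓ) (+ 21)))))

open Ladder using (ladder; ladder-simple; ladder-cubic)
open Connectivity using (ladder-twoConnected)
open TourLength using (tour-long)
open Drawing using (ladder-planar)
open Estimate using (blocks-for; estimate)
open import Data.Nat using (ℕ)
open import Data.Product using (Σ; _×_; _,_)
open import Data.Integer using (+_)
open import Data.Rational using (ℚ; 0ℚ; _<_; _≤_; _-_; _*_; _/_)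

theorem1 : (ε : ℚ) → 0ℚ < ε →
    Σ ℕ λ n → Σ (Adjacency n) λ adj →
    IsSimple adj × TwoConnected adj × Planar adj × Cubic adj ×
    ((t : TSPTour adj) → ((+ 5) / 4 - ε) * ((+ n) / 1) ≤ (+ tourLength adj t) / 1)
theorem1 ε ε>0 = _ , ladder N , ladder-simple N , ladder-twoConnected N , ladder-planar N , ladder-cubic N ,
    λ t → estimate ε ε>0 (tourLength (ladder N) t) (tour-long N t)
  where N = blocks-for ε
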